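{- For $k\ge1$ let $M_k$ be the number of Motzkin trees with $k$ vertices. For $n,k\ge1$ let $t_{n,k}$ be the total number, over all Motzkin trees with $n$ vertices, of vertices having a subtree of size $k$. Then: (i) for every $k\ge1$, $$\sum_{n\ge1}t_{n,k}x^n=\frac{M_kx^k}{\sqrt{1-2x-3x^2}};$$ (ii) for every $k\ge1$, the probability that a uniformly random vertex, among all vertices of all Motzkin trees with $n$ vertices, has a subtree of size $k$ (namely $t_{n,k}/(nM_n)$) tends to $M_k\left(\frac13\right)^k$ as $n\to\infty$; (iii) $\displaystyle\sum_{k\ge1}M_k\left(\frac13\right)^k=1$.
   Context: A Motzkin tree is a finite nonempty rooted plane tree (the children of each vertex are linearly ordered) in which every vertex has at most two children; a single child carries no left/right distinction. Trees are counted up to isomorphism of rooted plane trees. A vertex $v$ has a subtree of size $k$ if the subtree consisting of $v$ and all its descendants has exactly $k$ vertices. $\sqrt{1-2x-3x^2}$ denotes the formal power series square root with constant term $1$. -}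

module Defs where

open import Data.Bool.Base using (if_then_else_)
open import Data.Empty using (⊥)
open import Data.Fin.Base as Fin using (Fin; toℕ; inject₁)
open import Data.Fin.Properties using (toℕ-inject₁; toℕ-fromℕ; toℕ<n)
import Data.Integer.Base as ℤ
open import Data.List.Base
  using (List; []; _∷_; [_]; _++_; map; filter; length; concatMap; cartesianProductWith)
open import Data.List.Properties using (length-++)
open import Data.List.Membership.Propositional using (_∈_)
open import Data.List.Membership.Propositional.Properties
  using (∈-map⁺; ∈-map⁻; ∈-++⁺ˡ; ∈-++⁺ʳ; ∈-cartesianProductWith⁺; ∈-cartesianProductWith⁻; ∈-filter⁺; ∈-filter⁻; ∈-++⁻)
open import Data.List.Relation.Unary.All as All using ([]; _∷_)
open import Data.List.Relation.Unary.Any using (here; there)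
open import Data.List.Relation.Unary.AllPairs using ([]; _∷_)
open import Data.List.Relation.Unary.Unique.Propositional using (Unique)
open import Data.List.Relation.Unary.Unique.Propositional.Properties
  using (map⁺; ++⁺; cartesianProductWith⁺; filter⁺)
open import Data.Nat.Base as ℕ using (ℕ; zero; suc; _∸_; s≤s; z≤n)
import Data.Nat.ListAction as ℕ
open import Data.Nat.Properties as ℕ using (_≟_)
open import Data.Product.Base using (_×_; _,_; proj₂; ∃-syntax)
open import Data.Rational.Base
  using (ℚ; 0ℚ; 1ℚ; ½; _+_; _*_; _-_; -_; _÷_; _/_; _<_; ∣_∣; NonZero; 1/_)
open import Data.Rational.Properties as ℚ using (+-*-commutativeRing)
open import Data.Rational.Solver using (module +-*-Solver)
open import Data.Sum.Base using (inj₁; inj₂)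
open import Function.Base using (_∘_)
open import Relation.Binary.PropositionalEquality
  using (_≡_; _≢_; refl; sym; trans; cong; cong₂; _≗_; module ≡-Reasoning)
open import Relation.Nullary.Decidable using (does; yes; no; dec-true; dec-false)

open import Algebra.Bundles using (CommutativeRing)
open import Algebra.Properties.Semiring.Sum
  (CommutativeRing.semiring +-*-commutativeRing) public
  using (sum; sum-syntax; sum⁺-syntax; sum-cong-≗; sum-init-last)
open import Algebra.Properties.Semiring.Exp
  (CommutativeRing.semiring +-*-commutativeRing) public
  using (_^_)

-- Isomorphism classes of rooted plane trees all of whose vertices have
-- at most two children; a constructor lists the subtrees at the root.
data MotzkinTree : Set where
  leaf   : MotzkinTree
  unary  : MotzkinTree → MotzkinTree
  binary : MotzkinTree → MotzkinTree → MotzkinTree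

size : MotzkinTree → ℕ
size leaf         = 1
size (unary t)    = suc (size t)
size (binary l r) = suc (size l ℕ.+ size r)

-- One entry for each vertex v of the tree: the subtree consisting of v
-- and all its descendants.
subtrees : MotzkinTree → List MotzkinTree
subtrees leaf           = [ leaf ]
subtrees t@(unary s)    = t ∷ subtrees s
subtrees t@(binary l r) = t ∷ subtrees l ++ subtrees r

-- Trees with at most h levels.
treesOfHeight≤ : ℕ → List MotzkinTree
treesOfHeight≤ zero    = []
treesOfHeight≤ (suc h) =
  leaf ∷ map unary ts ++ cartesianProductWith binary ts ts
  where ts = treesOfHeight≤ h

-- A tree with n vertices has at most n levels, so this lists every
-- Motzkin tree with n vertices exactly once: see ∈-trees⁺, ∈-trees⁻ and
-- trees-unique.
trees : ℕ → List MotzkinTree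
trees n = filter (λ t → size t ≟ n) (treesOfHeight≤ n)

M : ℕ → ℕ
M n = length (trees n)

#verticesWithSubtreeSize : ℕ → MotzkinTree → ℕ
#verticesWithSubtreeSize k t = length (filter (λ s → size s ≟ k) (subtrees t))

t : ℕ → ℕ → ℕ
t n k = ℕ.sum (map (#verticesWithSubtreeSize k) (trees n))

∈-treesOfHeight≤ : ∀ h s → size s ℕ.≤ h → s ∈ treesOfHeight≤ h
∈-treesOfHeight≤ (suc h) leaf _ = here refl
∈-treesOfHeight≤ (suc h) (unary s) (s≤s le) =
  there (∈-++⁺ˡ (∈-map⁺ unary (∈-treesOfHeight≤ h s le)))
∈-treesOfHeight≤ (suc h) (binary l r) (s≤s le) =
  there (∈-++⁺ʳ (map unary (treesOfHeight≤ h))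
    (∈-cartesianProductWith⁺ binary
      (∈-treesOfHeight≤ h l (ℕ.≤-trans (ℕ.m≤m+n _ _) le))
      (∈-treesOfHeight≤ h r (ℕ.≤-trans (ℕ.m≤n+m _ _) le))))

∈-trees⁺ : ∀ {n} s → size s ≡ n → s ∈ trees n
∈-trees⁺ s refl =
  ∈-filter⁺ (λ t → size t ≟ size s) (∈-treesOfHeight≤ (size s) s ℕ.≤-refl) refl

∈-trees⁻ : ∀ {n s} → s ∈ trees n → size s ≡ n
∈-trees⁻ {n} s∈ = proj₂ (∈-filter⁻ (λ t → size t ≟ n) {xs = treesOfHeight≤ n} s∈)

treesOfHeight≤-unique : ∀ h → Unique (treesOfHeight≤ h)
treesOfHeight≤-unique zero    = []
treesOfHeight≤-unique (suc h) =
  All.tabulate leaf∉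
  ∷ ++⁺ (map⁺ (λ { refl → refl }) u)
        (cartesianProductWith⁺ binary (λ { refl → refl , refl }) u u)
        disjoint
  where
  ts = treesOfHeight≤ h
  u  = treesOfHeight≤-unique h

  leaf∉ : ∀ {s} → s ∈ map unary ts ++ cartesianProductWith binary ts ts → leaf ≢ s
  leaf∉ s∈ refl with ∈-++⁻ (map unary ts) s∈
  ... | inj₁ p with _ , _ , () ← ∈-map⁻ unary p
  ... | inj₂ q
    with _ , _ , _ , _ , () ← ∈-cartesianProductWith⁻ binary ts ts q

  disjoint : ∀ {s} → s ∈ map unary ts × s ∈ cartesianProductWith binary ts ts → ⊥
  disjoint (p , q)
    with _ , _ , refl ← ∈-map⁻ unary p
    with _ , _ , _ , _ , () ← ∈-cartesianProductWith⁻ binary ts ts q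

trees-unique : ∀ n → Unique (trees n)
trees-unique n = filter⁺ (λ t → size t ≟ n) (treesOfHeight≤-unique n)

private
  path : ℕ → MotzkinTree
  path zero    = leaf
  path (suc n) = unary (path n)

  size-path : ∀ n → size (path n) ≡ suc n
  size-path zero    = refl
  size-path (suc n) = cong suc (size-path n)

  ∈⇒nonZero : ∀ {A : Set} {x : A} {xs} → x ∈ xs → ℕ.NonZero (length xs)
  ∈⇒nonZero (here _)  = _
  ∈⇒nonZero (there _) = _

instance
  M-nonZero : ∀ {n} → .{{_ : ℕ.NonZero n}} → ℕ.NonZero (M n)
  M-nonZero {suc n} = ∈⇒nonZero (∈-trees⁺ (path n) (size-path n))

length-subtrees : ∀ s → length (subtrees s) ≡ size s
length-subtrees leaf         = refl
length-subtrees (unary s)    = cong suc (length-subtrees s)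
length-subtrees (binary l r) = cong suc
  (trans (length-++ (subtrees l))
         (cong₂ ℕ._+_ (length-subtrees l) (length-subtrees r)))

-- There are n * M n vertices in total among the trees with n vertices.
#allVertices : ∀ n → length (concatMap subtrees (trees n)) ≡ n ℕ.* M n
#allVertices n = trans (go (trees n) ∈-trees⁻) (ℕ.*-comm (M n) n)
  where
  go : ∀ ts → (∀ {s} → s ∈ ts → size s ≡ n) →
       length (concatMap subtrees ts) ≡ length ts ℕ.* n
  go []       _ = refl
  go (s ∷ ts) p = trans (length-++ (subtrees s))
    (cong₂ ℕ._+_ (trans (length-subtrees s) (p (here refl))) (go ts (p ∘ there)))

-- The probability that a uniformly random vertex, among all vertices of
-- all Motzkin trees with n vertices, has a subtree of size k.
prob : (n : ℕ) .{{_ : ℕ.NonZero n}} → ℕ → ℚ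
prob n k = (ℤ.+ t n k / (n ℕ.* M n)) {{ℕ.m*n≢0 n (M n)}}

fromℕ : ℕ → ℚ
fromℕ n = ℤ.+ n / 1

PowerSeries : Set
PowerSeries = ℕ → ℚ

-- ∑_{n≥1} aₙ xⁿ; the value a 0 is not used.
gf≥1 : (ℕ → ℕ) → PowerSeries
gf≥1 a zero    = 0ℚ
gf≥1 a (suc n) = fromℕ (a (suc n))

-- The series c xᵐ.
monomial : ℚ → ℕ → PowerSeries
monomial c m n = if does (n ≟ m) then c else 0ℚ

infixl 6 _⊕_
infixl 7 _⊛_ _⊘_

_⊕_ : PowerSeries → PowerSeries → PowerSeries
(f ⊕ g) n = f n + g n

_⊛_ : PowerSeries → PowerSeries → PowerSeries
(f ⊛ g) n = ∑[ i ≤ n ] (f (toℕ i) * g (n ∸ toℕ i))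

-- The quotient by an invertible series, by long division: see ⊘-⊛.
_⊘_ : (f g : PowerSeries) .{{_ : NonZero (g 0)}} → PowerSeries
(f ⊘ g) zero    = f 0 ÷ g 0
(f ⊘ g) (suc n) = ((λ m → f (suc m) - (f 0 ÷ g 0) * g (suc m)) ⊘ g) n

-- The square root with constant term 1 of a series f with constant
-- term 1: see sqrt-⊛.  sqrtTrunc f n is its truncation after xⁿ.
sqrtTrunc : PowerSeries → ℕ → PowerSeries
sqrtTrunc f zero    = monomial 1ℚ 0
sqrtTrunc f (suc n) =
  s ⊕ monomial (½ * (f (suc n) - (s ⊛ s) (suc n))) (suc n)
  where s = sqrtTrunc f n

sqrt : PowerSeries → PowerSeries
sqrt f n = sqrtTrunc f n n

⊘-⊛ : ∀ f g .{{_ : NonZero (g 0)}} → (f ⊘ g) ⊛ g ≗ f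
⊘-⊛ f g zero = begin
  f 0 * 1/ (g 0) * g 0 + 0ℚ  ≡⟨ ℚ.+-identityʳ _ ⟩
  f 0 * 1/ (g 0) * g 0       ≡⟨ ℚ.*-assoc (f 0) _ _ ⟩
  f 0 * (1/ (g 0) * g 0)     ≡⟨ cong (f 0 *_) (ℚ.*-inverseˡ (g 0)) ⟩
  f 0 * 1ℚ                   ≡⟨ ℚ.*-identityʳ (f 0) ⟩
  f 0                        ∎
  where open ≡-Reasoning
⊘-⊛ f g (suc n) = begin
  q * g (suc n) + (((λ m → f (suc m) - q * g (suc m)) ⊘ g) ⊛ g) n
    ≡⟨ cong (q * g (suc n) +_) (⊘-⊛ (λ m → f (suc m) - q * g (suc m)) g n) ⟩
  q * g (suc n) + (f (suc n) - q * g (suc n))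
    ≡⟨ solve 2 (λ a b → a :+ (b :- a) := b) refl (q * g (suc n)) (f (suc n)) ⟩
  f (suc n) ∎
  where
  open ≡-Reasoning
  open +-*-Solver
  q = f 0 ÷ g 0

private
  inner : PowerSeries → ℕ → ℚ
  inner g n = ∑[ i < n ] (g (suc (toℕ i)) * g (n ∸ toℕ i))

  inner-cong : ∀ f g n → (∀ i → i ℕ.≤ n → f i ≡ g i) → inner f n ≡ inner g n
  inner-cong f g n eq = sum-cong-≗ {n} λ i →
    cong₂ _*_ (eq _ (toℕ<n i)) (eq _ (ℕ.m∸n≤m n (toℕ i)))

  square-suc : ∀ g n → g 0 ≡ 1ℚ →
    (g ⊛ g) (suc n) ≡ g (suc n) + g (suc n) + inner g n
  square-suc g n g0 = begin
    g 0 * g (suc n) + ∑[ i ≤ n ] (u (toℕ i))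
      ≡⟨ cong₂ _+_ (trans (cong (_* g (suc n)) g0) (ℚ.*-identityˡ (g (suc n))))
                   (sum-init-last {n} (u ∘ toℕ)) ⟩
    g (suc n) + (∑[ i < n ] (u (toℕ (inject₁ i))) + u (toℕ (Fin.fromℕ n)))
      ≡⟨ cong (g (suc n) +_) (cong₂ _+_
           (sum-cong-≗ {n} (λ i → cong u (toℕ-inject₁ i)))
           (trans (cong u (toℕ-fromℕ n)) last≡)) ⟩
    g (suc n) + (inner g n + g (suc n))
      ≡⟨ solve 2 (λ a b → a :+ (b :+ a) := a :+ a :+ b) refl (g (suc n)) (inner g n) ⟩
    g (suc n) + g (suc n) + inner g n ∎
    where
    open ≡-Reasoning
    open +-*-Solver
    u : ℕ → ℚ
    u i = g (suc i) * g (n ∸ i)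
    last≡ : u n ≡ g (suc n)
    last≡ = trans (cong (λ m → g (suc n) * g m) (ℕ.n∸n≡0 n))
                  (trans (cong (g (suc n) *_) g0) (ℚ.*-identityʳ _))

  monomial-≢ : ∀ c {m n} → n ≢ m → monomial c m n ≡ 0ℚ
  monomial-≢ c {m} {n} n≢m =
    cong (λ b → if b then c else 0ℚ) (dec-false (n ≟ m) n≢m)

  monomial-≡ : ∀ c m → monomial c m m ≡ c
  monomial-≡ c m =
    cong (λ b → if b then c else 0ℚ) (dec-true (m ≟ m) refl)

  sqrtTrunc-> : ∀ f n {i} → n ℕ.< i → sqrtTrunc f n i ≡ 0ℚ
  sqrtTrunc-> f zero    n<i = monomial-≢ 1ℚ (ℕ.>⇒≢ n<i)
  sqrtTrunc-> f (suc n) n<i =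
    cong₂ _+_ (sqrtTrunc-> f n (ℕ.<-trans (ℕ.n<1+n n) n<i))
              (monomial-≢ _ (ℕ.>⇒≢ n<i))

  sqrtTrunc-≤ : ∀ f n {i} → i ℕ.≤ n → sqrtTrunc f n i ≡ sqrt f i
  sqrtTrunc-≤ f zero    z≤n = refl
  sqrtTrunc-≤ f (suc n) {i} i≤1+n with i ≟ suc n
  ... | yes refl  = refl
  ... | no  i≢1+n =
    trans (cong (sqrtTrunc f n i +_) (monomial-≢ _ i≢1+n))
      (trans (ℚ.+-identityʳ _) (sqrtTrunc-≤ f n (ℕ.≤-pred (ℕ.≤∧≢⇒< i≤1+n i≢1+n))))

sqrt-⊛ : ∀ f → f 0 ≡ 1ℚ → sqrt f ⊛ sqrt f ≗ f
sqrt-⊛ f f0 zero    = sym f0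
sqrt-⊛ f f0 (suc n) = begin
  (r ⊛ r) (suc n)
    ≡⟨ square-suc r n refl ⟩
  r (suc n) + r (suc n) + inner r n
    ≡⟨ cong (λ a → a + a + inner r n) r≡ ⟩
  ½ * (f (suc n) - inner r n) + ½ * (f (suc n) - inner r n) + inner r n
    ≡⟨ solve 2 (λ a b → con ½ :* (a :- b) :+ con ½ :* (a :- b) :+ b := a) refl
         (f (suc n)) (inner r n) ⟩
  f (suc n) ∎
  where
  open ≡-Reasoning
  open +-*-Solver
  r = sqrt f
  s = sqrtTrunc f n

  s² : (s ⊛ s) (suc n) ≡ inner r n
  s² = begin
    (s ⊛ s) (suc n)
      ≡⟨ square-suc s n (sqrtTrunc-≤ f n z≤n) ⟩
    s (suc n) + s (suc n) + inner s n
      ≡⟨ cong₂ _+_ (cong (λ a → a + a) (sqrtTrunc-> f n (ℕ.n<1+n n)))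
                   (inner-cong s r n (λ _ → sqrtTrunc-≤ f n)) ⟩
    0ℚ + inner r n
      ≡⟨ ℚ.+-identityˡ _ ⟩
    inner r n ∎

  r≡ : r (suc n) ≡ ½ * (f (suc n) - inner r n)
  r≡ = begin
    s (suc n) + monomial (½ * (f (suc n) - (s ⊛ s) (suc n))) (suc n) (suc n)
      ≡⟨ cong₂ _+_ (sqrtTrunc-> f n (ℕ.n<1+n n)) (monomial-≡ _ (suc n)) ⟩
    0ℚ + ½ * (f (suc n) - (s ⊛ s) (suc n))
      ≡⟨ ℚ.+-identityˡ _ ⟩
    ½ * (f (suc n) - (s ⊛ s) (suc n))
      ≡⟨ cong (λ a → ½ * (f (suc n) - a)) s² ⟩
    ½ * (f (suc n) - inner r n) ∎

1-2x-3x² : PowerSeries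
1-2x-3x² = monomial 1ℚ 0 ⊕ monomial (- fromℕ 2) 1 ⊕ monomial (- fromℕ 3) 2

infix 4 _⟶_

_⟶_ : (ℕ → ℚ) → ℚ → Set
a ⟶ L = ∀ ε → 0ℚ < ε → ∃[ N ] (∀ n → N ℕ.≤ n → ∣ a n - L ∣ < ε)

-- ∑_{k≥1} aₖ = L; the n-th partial sum is a 1 + ⋯ + a n.
Series≥1 : (ℕ → ℚ) → ℚ → Set
Series≥1 a L = (λ n → ∑[ i < n ] a (suc (toℕ i))) ⟶ L

⅓ : ℚ
⅓ = ℤ.+ 1 / 3

{-# OPTIONS --safe #-}

-- With M(x) = ∑ Mₙ xⁿ, decomposing a tree at its root gives M = x (1 + M + M²), so
-- Q = 1 − x − 2 x M satisfies Q² = 1 − 2x − 3x²; and if a statistic of trees is the sum over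
-- all vertices of a function r of the subtrees, then its generating function times Q is the
-- generating function of r.  For r = [size = k] this is (i).
--
-- Let C(x) = 1/Q, whose coefficients are the central trinomial coefficients Cₙ = tₙ₊₁,₁, so
-- that tₙ,ₖ = Mₖ Cₙ₋ₖ.  Applying x d/dx to C Q = 1 gives a three-term recurrence for Cₙ,
-- hence 3 − 2/(n+1) ≤ Cₙ₊₁/Cₙ ≤ 3.  For r = 1 we get 2 n Mₙ = Cₙ₊₁ − Cₙ, hence
-- n Mₙ ≤ Cₙ ≤ (n+1) Mₙ; together these squeeze 3ᵏ tₙ,ₖ/(n Mₙ) between Mₖ and
-- Mₖ (n+1)/(n−k), which is (ii).
--
-- For (iii), the tail 1 − ∑_{k≤n} Mₖ 3⁻ᵏ is exactly (Cₙ + Cₙ₊₁)/(2·3ⁿ), and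
-- (n+1) Cₙ³ ≤ 27ⁿ.
module Submission where

open import Defs
open import Algebra.Bundles using (CommutativeRing)
import Algebra.Construct.Pointwise as Pointwise
import Algebra.Solver.Ring
open import Algebra.Solver.Ring.AlmostCommutativeRing
  using (fromCommutativeRing; _-Raw-AlmostCommutative⟶_)
open import Data.Bool.Base using (if_then_else_; true; false)
open import Data.Fin.Base using (toℕ)
open import Data.Fin.Properties using (toℕ-inject₁; toℕ-fromℕ)
import Data.Integer.Base as ℤ
import Data.Integer.Properties as ℤ
open import Data.List.Base using (List; []; _∷_; _++_; map; filter; length; cartesianProductWith)
open import Data.List.Membership.Propositional using (_∈_)
open import Data.List.Membership.Propositional.Properties using (∈-filter⁺; ∈-filter⁻)
open import Data.List.Membership.Propositional.Properties.WithK using (unique∧set⇒bag)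
open import Data.List.Properties using (filter-accept; filter-reject; filter-++; length-++)
open import Data.List.Relation.Binary.BagAndSetEquality using (∼bag⇒↭)
open import Data.List.Relation.Binary.Permutation.Propositional using (_↭_)
import Data.List.Relation.Binary.Permutation.Propositional.Properties as ↭
open import Data.List.Relation.Unary.Any using (here; there)
open import Data.List.Relation.Unary.Unique.Propositional.Properties using (filter⁺)
import Data.Maybe.Base as Maybe
open import Data.Nat.Base as ℕ using (ℕ; zero; suc; _∸_; _≤_; s≤s; z≤n)
import Data.Nat.ListAction as ℕ
open import Data.Nat.ListAction.Properties using (sum-↭)
import Data.Nat.Properties as ℕ
import Data.Nat.Solver
open import Data.Product.Base using (_×_; _,_; proj₁; proj₂)
open import Data.Rational.Base as ℚ
  using (ℚ; mkℚ; 0ℚ; 1ℚ; ½; _+_; _*_; -_; _-_; _<_; ∣_∣; NonZero; NonNegative; Positive)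
import Data.Rational.Properties as ℚ
import Data.Rational.Solver
import Data.Rational.Unnormalised.Base as ℚᵘ
import Data.Rational.Unnormalised.Properties as ℚᵘ
open import Function.Base using (_∘_)
open import Function.Bundles using (mk⇔)
open import Level using (0ℓ)
open import Relation.Binary.PropositionalEquality
open import Relation.Nullary.Decidable using (yes; no; does; dec-true; dec-false; dec⇒maybe)
open import Relation.Nullary.Negation using (contradiction)

-- The ring of formal power series

infix 8 ⊝_

0# 1# X : PowerSeries
0# _ = 0ℚ
1#   = monomial 1ℚ 0
X    = monomial 1ℚ 1

const : ℚ → PowerSeries
const c = monomial c 0

⊝_ : PowerSeries → PowerSeries
(⊝ f) n = - f n

tail : PowerSeries → PowerSeries
tail f n = f (suc n)

module _ where
  open ≡-Reasoning
  open Data.Rational.Solver.+-*-Solver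

  -- Locality of the product: this is what carries identities between truncated sums, correct only
  -- up to some degree, over to the full generating functions.
  ⊛-agree : ∀ n {f f′ g g′} → (∀ i → i ℕ.≤ n → f i ≡ f′ i) →
            (∀ i → i ℕ.≤ n → g i ≡ g′ i) → (f ⊛ g) n ≡ (f′ ⊛ g′) n
  ⊛-agree zero    p q = cong₂ (λ a b → a * b + 0ℚ) (p 0 ℕ.z≤n) (q 0 ℕ.z≤n)
  ⊛-agree (suc n) p q = cong₂ _+_
    (cong₂ _*_ (p 0 ℕ.z≤n) (q (suc n) ℕ.≤-refl))
    (⊛-agree n (λ i i≤n → p (suc i) (ℕ.s≤s i≤n)) (λ i i≤n → q i (ℕ.m≤n⇒m≤1+n i≤n)))

  ⊛-cong : ∀ {f f′ g g′} → f ≗ f′ → g ≗ g′ → f ⊛ g ≗ f′ ⊛ g′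
  ⊛-cong p q n = ⊛-agree n (λ i _ → p i) (λ i _ → q i)

  ⊛-zeroˡ : ∀ g → 0# ⊛ g ≗ 0#
  ⊛-zeroˡ g zero    = solve 1 (λ a → con 0ℚ :* a :+ con 0ℚ := con 0ℚ) refl (g 0)
  ⊛-zeroˡ g (suc n) = trans (cong (0ℚ * g (suc n) +_) (⊛-zeroˡ g n))
    (solve 1 (λ a → con 0ℚ :* a :+ con 0ℚ := con 0ℚ) refl (g (suc n)))

  const-⊛ : ∀ c g n → (const c ⊛ g) n ≡ c * g n
  const-⊛ c g zero    = ℚ.+-identityʳ _
  const-⊛ c g (suc n) = trans (cong (c * g (suc n) +_) (⊛-zeroˡ g n)) (ℚ.+-identityʳ _)

  ⊛-distribʳ : ∀ h f g → (f ⊕ g) ⊛ h ≗ (f ⊛ h) ⊕ (g ⊛ h)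
  ⊛-distribʳ h f g zero    =
    solve 3 (λ a b c → (a :+ b) :* c :+ con 0ℚ := (a :* c :+ con 0ℚ) :+ (b :* c :+ con 0ℚ))
      refl (f 0) (g 0) (h 0)
  ⊛-distribʳ h f g (suc n) = trans
    (cong ((f 0 + g 0) * h (suc n) +_) (⊛-distribʳ h (tail f) (tail g) n))
    (solve 5 (λ a b c d e → (a :+ b) :* c :+ (d :+ e) := (a :* c :+ d) :+ (b :* c :+ e))
      refl (f 0) (g 0) (h (suc n)) ((tail f ⊛ h) n) ((tail g ⊛ h) n))

  scale-⊛ : ∀ c f g n → ((λ i → c * f i) ⊛ g) n ≡ c * (f ⊛ g) n
  scale-⊛ c f g zero    =
    solve 3 (λ c a b → c :* a :* b :+ con 0ℚ := c :* (a :* b :+ con 0ℚ)) refl c (f 0) (g 0)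
  scale-⊛ c f g (suc n) = trans
    (cong (c * f 0 * g (suc n) +_) (scale-⊛ c (tail f) g n))
    (solve 4 (λ c a b d → c :* a :* b :+ c :* d := c :* (a :* b :+ d))
      refl c (f 0) (g (suc n)) ((tail f ⊛ g) n))

  ⊛-assoc : ∀ f g h → (f ⊛ g) ⊛ h ≗ f ⊛ (g ⊛ h)
  ⊛-assoc f g h zero    =
    solve 3 (λ a b c → (a :* b :+ con 0ℚ) :* c :+ con 0ℚ := a :* (b :* c :+ con 0ℚ) :+ con 0ℚ)
      refl (f 0) (g 0) (h 0)
  ⊛-assoc f g h (suc n) = begin
    (f 0 * g 0 + 0ℚ) * h (suc n) + (((λ i → f 0 * g (suc i)) ⊕ (tail f ⊛ g)) ⊛ h) n
      ≡⟨ cong ((f 0 * g 0 + 0ℚ) * h (suc n) +_)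
           (trans (⊛-distribʳ h (λ i → f 0 * g (suc i)) (tail f ⊛ g) n)
             (cong₂ _+_ (scale-⊛ (f 0) (tail g) h n) (⊛-assoc (tail f) g h n))) ⟩
    (f 0 * g 0 + 0ℚ) * h (suc n) + (f 0 * (tail g ⊛ h) n + (tail f ⊛ (g ⊛ h)) n)
      ≡⟨ solve 5 (λ a b c d e → (a :* b :+ con 0ℚ) :* c :+ (a :* d :+ e) :=
                                a :* (b :* c :+ d) :+ e)
           refl (f 0) (g 0) (h (suc n)) ((tail g ⊛ h) n) ((tail f ⊛ (g ⊛ h)) n) ⟩
    f 0 * (g 0 * h (suc n) + (tail g ⊛ h) n) + (tail f ⊛ (g ⊛ h)) n ∎

  -- The product unfolds by peeling its left factor; this mirror image peels the right factor, which
  -- is what the induction for commutativity needs.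
  ⊛-sucʳ : ∀ f g n → (f ⊛ g) (suc n) ≡ f (suc n) * g 0 + (f ⊛ tail g) n
  ⊛-sucʳ f g zero    =
    solve 4 (λ a b c d → a :* b :+ (c :* d :+ con 0ℚ) := c :* d :+ (a :* b :+ con 0ℚ))
      refl (f 0) (g 1) (f 1) (g 0)
  ⊛-sucʳ f g (suc n) = trans
    (cong (f 0 * g (suc (suc n)) +_) (⊛-sucʳ (tail f) g n))
    (solve 3 (λ a b c → a :+ (b :+ c) := b :+ (a :+ c)) refl
      (f 0 * g (suc (suc n))) (f (suc (suc n)) * g 0) ((tail f ⊛ tail g) n))

  ⊛-comm : ∀ f g → f ⊛ g ≗ g ⊛ f
  ⊛-comm f g zero    = cong (_+ 0ℚ) (ℚ.*-comm (f 0) (g 0))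
  ⊛-comm f g (suc n) = trans
    (cong₂ _+_ (ℚ.*-comm (f 0) (g (suc n))) (⊛-comm (tail f) g n))
    (sym (⊛-sucʳ g f n))

  ⊛-identityˡ : ∀ f → 1# ⊛ f ≗ f
  ⊛-identityˡ f n = trans (const-⊛ 1ℚ f n) (ℚ.*-identityˡ (f n))

powerSeriesRing : CommutativeRing 0ℓ 0ℓ
powerSeriesRing = record
  { _≈_ = _≗_
  ; _+_ = _⊕_
  ; _*_ = _⊛_
  ; -_  = ⊝_
  ; 0#  = 0#
  ; 1#  = 1#
  ; isCommutativeRing = record
    { isRing = record
      { +-isAbelianGroup = Pointwise.isAbelianGroup ℕ ℚ.+-0-isAbelianGroup
      ; *-cong     = ⊛-cong
      ; *-assoc    = ⊛-assoc
      ; *-identity = ⊛-identityˡ , λ f n → trans (⊛-comm f 1# n) (⊛-identityˡ f n)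
      ; distrib    = (λ h f g n → trans (⊛-comm h (f ⊕ g) n)
                       (trans (⊛-distribʳ h f g n)
                         (cong₂ _+_ (⊛-comm f h n) (⊛-comm g h n))))
                   , ⊛-distribʳ
      }
    ; *-comm = ⊛-comm
    }
  }

module PS = CommutativeRing powerSeriesRing

-- Embedding `ℚ` as the constant series lets the ring solver normalise polynomials in power series
-- with rational coefficients.
constHomomorphism : CommutativeRing.rawRing ℚ.+-*-commutativeRing
                    -Raw-AlmostCommutative⟶ fromCommutativeRing powerSeriesRing
constHomomorphism = record
  { ⟦_⟧    = const
  ; +-homo = λ { c d zero → refl ; c d (suc n) → refl }
  ; *-homo = λ { c d zero → sym (const-⊛ c (const d) 0)
               ; c d (suc n) → sym (trans (const-⊛ c (const d) (suc n)) (ℚ.*-zeroʳ c)) }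
  ; -‿homo = λ { c zero → refl ; c (suc n) → refl }
  ; 0-homo = λ { zero → refl ; (suc n) → refl }
  ; 1-homo = λ _ → refl
  }

module PS-Solver = Algebra.Solver.Ring
  (CommutativeRing.rawRing ℚ.+-*-commutativeRing)
  (fromCommutativeRing powerSeriesRing)
  constHomomorphism
  (λ c d → Maybe.map (λ c≡d n → cong (λ e → const e n) c≡d) (dec⇒maybe (c ℚ.≟ d)))

-- Generating functions of statistics of trees

toℚᵘ-fromℕ : ∀ n → ℚ.toℚᵘ (fromℕ n) ℚᵘ.≃ ℚᵘ.mkℚᵘ (ℤ.+ n) 0
toℚᵘ-fromℕ n = ℚ.toℚᵘ-fromℚᵘ (ℚᵘ.mkℚᵘ (ℤ.+ n) 0)

fromℕ-+ : ∀ m n → fromℕ (m ℕ.+ n) ≡ fromℕ m + fromℕ n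
fromℕ-+ m n = ℚ.toℚᵘ-injective (begin
  ℚ.toℚᵘ (fromℕ (m ℕ.+ n))                         ≈⟨ toℚᵘ-fromℕ (m ℕ.+ n) ⟩
  ℚᵘ.mkℚᵘ (ℤ.+ (m ℕ.+ n)) 0                         ≈⟨ ℚᵘ.*≡* (cong (ℤ._* ℤ.1ℤ)
    (cong₂ ℤ._+_ (sym (ℤ.*-identityʳ (ℤ.+ m))) (sym (ℤ.*-identityʳ (ℤ.+ n))))) ⟩
  ℚᵘ.mkℚᵘ (ℤ.+ m) 0 ℚᵘ.+ ℚᵘ.mkℚᵘ (ℤ.+ n) 0          ≈⟨ ℚᵘ.+-cong (toℚᵘ-fromℕ m) (toℚᵘ-fromℕ n) ⟨
  ℚ.toℚᵘ (fromℕ m) ℚᵘ.+ ℚ.toℚᵘ (fromℕ n)           ≈⟨ ℚ.toℚᵘ-homo-+ (fromℕ m) (fromℕ n) ⟨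
  ℚ.toℚᵘ (fromℕ m + fromℕ n)                        ∎)
  where open import Relation.Binary.Reasoning.Setoid ℚᵘ.≃-setoid

fromℕ-* : ∀ m n → fromℕ (m ℕ.* n) ≡ fromℕ m * fromℕ n
fromℕ-* m n = ℚ.toℚᵘ-injective (begin
  ℚ.toℚᵘ (fromℕ (m ℕ.* n))                         ≈⟨ toℚᵘ-fromℕ (m ℕ.* n) ⟩
  ℚᵘ.mkℚᵘ (ℤ.+ (m ℕ.* n)) 0                         ≈⟨ ℚᵘ.*≡* (cong (ℤ._* ℤ.1ℤ) (ℤ.pos-* m n)) ⟩
  ℚᵘ.mkℚᵘ (ℤ.+ m) 0 ℚᵘ.* ℚᵘ.mkℚᵘ (ℤ.+ n) 0          ≈⟨ ℚᵘ.*-cong (toℚᵘ-fromℕ m) (toℚᵘ-fromℕ n) ⟨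
  ℚ.toℚᵘ (fromℕ m) ℚᵘ.* ℚ.toℚᵘ (fromℕ n)           ≈⟨ ℚ.toℚᵘ-homo-* (fromℕ m) (fromℕ n) ⟨
  ℚ.toℚᵘ (fromℕ m * fromℕ n)                        ∎)
  where open import Relation.Binary.Reasoning.Setoid ℚᵘ.≃-setoid

monomial-≡ : ∀ c m → monomial c m m ≡ c
monomial-≡ c m = cong (λ b → if b then c else 0ℚ) (dec-true (m ℕ.≟ m) refl)

monomial-≢ : ∀ c {m n} → n ≢ m → monomial c m n ≡ 0ℚ
monomial-≢ c {m} {n} n≢m = cong (λ b → if b then c else 0ℚ) (dec-false (n ℕ.≟ m) n≢m)

monomial-+ : ∀ c d m → monomial (c + d) m ≗ monomial c m ⊕ monomial d m
monomial-+ c d m n with n ℕ.≟ m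
... | yes refl rewrite monomial-≡ (c + d) m | monomial-≡ c m | monomial-≡ d m = refl
... | no  n≢m  rewrite monomial-≢ (c + d) n≢m | monomial-≢ c n≢m | monomial-≢ d n≢m = refl

monomial-suc : ∀ c m → monomial c (suc m) ≗ X ⊛ monomial c m
monomial-suc c m zero    =
  sym (trans (ℚ.+-identityʳ (0ℚ * monomial c m 0)) (ℚ.*-zeroˡ (monomial c m 0)))
monomial-suc c m (suc n) = sym (trans
  (cong₂ _+_ (ℚ.*-zeroˡ (monomial c m (suc n))) (⊛-identityˡ (monomial c m) n))
  (ℚ.+-identityˡ _))

monomial-⊛ : ∀ c d m n → monomial c m ⊛ monomial d n ≗ monomial (c * d) (m ℕ.+ n)
monomial-⊛ c d zero    n i = trans (const-⊛ c (monomial d n) i) scale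
  where
  scale : c * monomial d n i ≡ monomial (c * d) n i
  scale with i ℕ.≟ n
  ... | yes refl rewrite monomial-≡ d n | monomial-≡ (c * d) n = refl
  ... | no  i≢n  rewrite monomial-≢ d i≢n | monomial-≢ (c * d) i≢n = ℚ.*-zeroʳ c
monomial-⊛ c d (suc m) n = begin
  monomial c (suc m) ⊛ monomial d n   ≈⟨ PS.*-congʳ {monomial d n} (monomial-suc c m) ⟩
  X ⊛ monomial c m ⊛ monomial d n     ≈⟨ ⊛-assoc X (monomial c m) (monomial d n) ⟩
  X ⊛ (monomial c m ⊛ monomial d n)   ≈⟨ PS.*-congˡ {X} (monomial-⊛ c d m n) ⟩
  X ⊛ monomial (c * d) (m ℕ.+ n)      ≈⟨ monomial-suc (c * d) (m ℕ.+ n) ⟨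
  monomial (c * d) (suc m ℕ.+ n)      ∎
  where open import Relation.Binary.Reasoning.Setoid PS.setoid

-- Sums of power series over lists

module _ {A : Set} where

  Σ[_] : (A → PowerSeries) → List A → PowerSeries
  Σ[ φ ] []       = 0#
  Σ[ φ ] (x ∷ xs) = φ x ⊕ Σ[ φ ] xs

  Σ-cong : ∀ {φ ψ} xs → (∀ x → φ x ≗ ψ x) → Σ[ φ ] xs ≗ Σ[ ψ ] xs
  Σ-cong []       eq n = refl
  Σ-cong (x ∷ xs) eq n = cong₂ _+_ (eq x n) (Σ-cong xs eq n)

  Σ-++ : ∀ φ xs ys → Σ[ φ ] (xs ++ ys) ≗ Σ[ φ ] xs ⊕ Σ[ φ ] ys
  Σ-++ φ []       ys n = sym (ℚ.+-identityˡ _)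
  Σ-++ φ (x ∷ xs) ys n =
    trans (cong (φ x n +_) (Σ-++ φ xs ys n)) (sym (ℚ.+-assoc (φ x n) _ _))

  Σ-⊕ : ∀ φ ψ xs → Σ[ (λ x → φ x ⊕ ψ x) ] xs ≗ Σ[ φ ] xs ⊕ Σ[ ψ ] xs
  Σ-⊕ φ ψ []       n = refl
  Σ-⊕ φ ψ (x ∷ xs) n = trans (cong (φ x n + ψ x n +_) (Σ-⊕ φ ψ xs n))
    (solve 4 (λ a b c d → a :+ b :+ (c :+ d) := a :+ c :+ (b :+ d)) refl
      (φ x n) (ψ x n) (Σ[ φ ] xs n) (Σ[ ψ ] xs n))
    where open Data.Rational.Solver.+-*-Solver

  Σ-⊛ˡ : ∀ f φ xs → Σ[ (λ x → f ⊛ φ x) ] xs ≗ f ⊛ Σ[ φ ] xs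
  Σ-⊛ˡ f φ []       n = sym (PS.zeroʳ f n)
  Σ-⊛ˡ f φ (x ∷ xs) n = trans (cong ((f ⊛ φ x) n +_) (Σ-⊛ˡ f φ xs n))
    (sym (PS.distribˡ f (φ x) (Σ[ φ ] xs) n))

  Σ-⊛ʳ : ∀ f φ xs → Σ[ (λ x → φ x ⊛ f) ] xs ≗ Σ[ φ ] xs ⊛ f
  Σ-⊛ʳ f φ []       n = sym (PS.zeroˡ f n)
  Σ-⊛ʳ f φ (x ∷ xs) n = trans (cong ((φ x ⊛ f) n +_) (Σ-⊛ʳ f φ xs n))
    (sym (PS.distribʳ f (φ x) (Σ[ φ ] xs) n))

Σ-map : ∀ {A B : Set} φ (f : A → B) xs → Σ[ φ ] (map f xs) ≗ Σ[ φ ∘ f ] xs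
Σ-map φ f []       n = refl
Σ-map φ f (x ∷ xs) n = cong (φ (f x) n +_) (Σ-map φ f xs n)

Σ-cartesianProductWith : ∀ {A B C : Set} φ (f : A → B → C) xs ys →
  Σ[ φ ] (cartesianProductWith f xs ys) ≗ Σ[ (λ x → Σ[ φ ∘ f x ] ys) ] xs
Σ-cartesianProductWith φ f []       ys n = refl
Σ-cartesianProductWith φ f (x ∷ xs) ys n = trans
  (Σ-++ φ (map (f x) ys) (cartesianProductWith f xs ys) n)
  (cong₂ _+_ (Σ-map φ (f x) ys n) (Σ-cartesianProductWith φ f xs ys n))

Σ-product : ∀ {A B : Set} (φ : A → PowerSeries) (ψ : B → PowerSeries) xs ys →
  Σ[ (λ x → Σ[ (λ y → φ x ⊛ ψ y) ] ys) ] xs ≗ Σ[ φ ] xs ⊛ Σ[ ψ ] ys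
Σ-product φ ψ xs ys n = trans
  (Σ-cong xs (λ x → Σ-⊛ˡ (φ x) ψ ys) n) (Σ-⊛ʳ (Σ[ ψ ] ys) φ xs n)

Weight : Set
Weight = MotzkinTree → ℕ

term : Weight → MotzkinTree → PowerSeries
term w s = monomial (fromℕ (w s)) (size s)

-- This is the sum of `term w s` over all trees `s`, given coefficientwise because that sum is
-- infinite. The finite sums over `treesOfHeight≤ h` agree with it up to degree `h`.
gf : Weight → PowerSeries
gf w n = fromℕ (ℕ.sum (map w (trees n)))

one : Weight
one _ = 1

Σ-term : ∀ w ts n → Σ[ term w ] ts n ≡ fromℕ (ℕ.sum (map w (filter (λ s → size s ℕ.≟ n) ts)))
Σ-term w []       n = refl
Σ-term w (s ∷ ts) n with size s ℕ.≟ n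
... | yes refl = trans (cong₂ _+_ (monomial-≡ _ n) (Σ-term w ts n))
  (trans (sym (fromℕ-+ (w s) _))
    (cong (fromℕ ∘ ℕ.sum ∘ map w) (sym (filter-accept (λ s → size s ℕ.≟ n) {s} {ts} refl))))
... | no  s≢n  = trans (cong₂ _+_ (monomial-≢ _ (s≢n ∘ sym)) (Σ-term w ts n))
  (trans (ℚ.+-identityˡ _)
    (cong (fromℕ ∘ ℕ.sum ∘ map w) (sym (filter-reject (λ s → size s ℕ.≟ n) {s} {ts} s≢n))))

-- Both lists are free of duplicates and have the same members, since a tree with `n` vertices has
-- at most `n` levels.
trees-↭ : ∀ {n h} → n ≤ h → filter (λ s → size s ℕ.≟ n) (treesOfHeight≤ h) ↭ trees n
trees-↭ {n} {h} n≤h = ∼bag⇒↭ (unique∧set⇒bag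
  (filter⁺ (λ s → size s ℕ.≟ n) (treesOfHeight≤-unique h)) (trees-unique n)
  (λ {s} → mk⇔
    (λ s∈ → ∈-trees⁺ s (proj₂ (∈-filter⁻ (λ s → size s ℕ.≟ n) {xs = treesOfHeight≤ h} s∈)))
    (λ s∈ → ∈-filter⁺ (λ s → size s ℕ.≟ n)
      (∈-treesOfHeight≤ h s (ℕ.≤-trans (ℕ.≤-reflexive (∈-trees⁻ s∈)) n≤h)) (∈-trees⁻ s∈))))

Σ-treesOfHeight≤ : ∀ w {n h} → n ≤ h → Σ[ term w ] (treesOfHeight≤ h) n ≡ gf w n
Σ-treesOfHeight≤ w {n} {h} n≤h = trans (Σ-term w (treesOfHeight≤ h) n)
  (cong fromℕ (sum-↭ (↭.map⁺ w (trees-↭ n≤h))))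

layers : ∀ φ h → let ts = treesOfHeight≤ h in
  Σ[ φ ] (treesOfHeight≤ (suc h)) ≗
  φ leaf ⊕ (Σ[ φ ∘ unary ] ts ⊕ Σ[ (λ l → Σ[ φ ∘ binary l ] ts) ] ts)
layers φ h n = cong (φ leaf n +_) (trans
  (Σ-++ φ (map unary ts) (cartesianProductWith binary ts ts) n)
  (cong₂ _+_ (Σ-map φ unary ts n) (Σ-cartesianProductWith φ binary ts ts n)))
  where ts = treesOfHeight≤ h

-- The factor `X` accounts for the root; the sizes of the two subtrees add in the exponent while
-- their weights multiply.
term-product : ∀ u v l r → X ⊛ (term u l ⊛ term v r) ≗
  monomial (fromℕ (u l ℕ.* v r)) (size (binary l r))
term-product u v l r n = trans
  (PS.*-congˡ {X} (monomial-⊛ (fromℕ (u l)) (fromℕ (v r)) (size l) (size r)) n)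
  (trans (cong (λ c → (X ⊛ monomial c (size l ℕ.+ size r)) n) (sym (fromℕ-* (u l) (v r))))
    (sym (monomial-suc (fromℕ (u l ℕ.* v r)) (size l ℕ.+ size r) n)))

Σ-term-product : ∀ u v ts →
  Σ[ (λ l → Σ[ (λ r → X ⊛ (term u l ⊛ term v r)) ] ts) ] ts ≗
  X ⊛ (Σ[ term u ] ts ⊛ Σ[ term v ] ts)
Σ-term-product u v ts n =
  trans (Σ-cong ts (λ l → Σ-⊛ˡ X (λ r → term u l ⊛ term v r) ts) n)
  (trans (Σ-⊛ˡ X (λ l → Σ[ (λ r → term u l ⊛ term v r) ] ts) ts n)
    (PS.*-congˡ {X} (Σ-product (term u) (term v) ts ts) n))

gf-one-step : ∀ h → let O = Σ[ term one ] (treesOfHeight≤ h) in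
  Σ[ term one ] (treesOfHeight≤ (suc h)) ≗ X ⊛ (1# ⊕ O ⊕ O ⊛ O)
gf-one-step h = begin
  Σ[ term one ] (treesOfHeight≤ (suc h))
    ≈⟨ layers (term one) h ⟩
  X ⊕ (Σ[ term one ∘ unary ] ts ⊕ Σ[ (λ l → Σ[ term one ∘ binary l ] ts) ] ts)
    ≈⟨ PS.+-congˡ {X} (PS.+-cong
         (PS.trans (Σ-cong ts (λ s → monomial-suc 1ℚ (size s))) (Σ-⊛ˡ X (term one) ts))
         (PS.trans
           (Σ-cong ts (λ l → Σ-cong ts (λ r n → sym (term-product one one l r n))))
           (Σ-term-product one one ts))) ⟩
  X ⊕ (X ⊛ O ⊕ X ⊛ (O ⊛ O))
    ≈⟨ solve 2 (λ x o → x :+ (x :* o :+ x :* (o :* o)) := x :* (con 1ℚ :+ o :+ o :* o))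
         (λ _ → refl) X O ⟩
  X ⊛ (1# ⊕ O ⊕ O ⊛ O) ∎
  where
  open import Relation.Binary.Reasoning.Setoid PS.setoid
  open PS-Solver
  ts = treesOfHeight≤ h
  O = Σ[ term one ] ts

gf-one : gf one ≗ X ⊛ (1# ⊕ gf one ⊕ gf one ⊛ gf one)
-- Coefficient `n` is read off at height `suc n`, so that removing the root leaves height `n`, where
-- all coefficients up to `n` are already final.
gf-one n = trans (sym (Σ-treesOfHeight≤ one (ℕ.n≤1+n n))) (trans (gf-one-step n n)
  (⊛-agree n {X} {X} (λ _ _ → refl) (λ i i≤n → cong₂ _+_
    (cong (1# i +_) (agree i i≤n))
    (⊛-agree i (λ j j≤i → agree j (ℕ.≤-trans j≤i i≤n)) (λ j j≤i → agree j (ℕ.≤-trans j≤i i≤n))))))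
  where
  agree : ∀ i → i ≤ n → Σ[ term one ] (treesOfHeight≤ n) i ≡ gf one i
  agree i = Σ-treesOfHeight≤ one

-- w s is the sum of r over subtrees s.
record Total (r w : Weight) : Set where
  field
    at-leaf   : w leaf ≡ r leaf
    at-unary  : ∀ s → w (unary s) ≡ r (unary s) ℕ.+ w s
    at-binary : ∀ s u → w (binary s u) ≡ r (binary s u) ℕ.+ (w s ℕ.+ w u)

module _ {r w : Weight} (total : Total r w) where
  open Total total

  term-split : ∀ s n i → w s ≡ r s ℕ.+ n →
               term w s i ≡ term r s i + monomial (fromℕ n) (size s) i
  term-split s n i eq = trans
    (cong (λ c → monomial c (size s) i) (trans (cong fromℕ eq) (fromℕ-+ (r s) n)))
    (monomial-+ (fromℕ (r s)) (fromℕ n) (size s) i)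

  term-unary : ∀ s → term w (unary s) ≗ term r (unary s) ⊕ X ⊛ term w s
  term-unary s i = trans (term-split (unary s) (w s) i (at-unary s))
    (cong (term r (unary s) i +_) (monomial-suc (fromℕ (w s)) (size s) i))

  term-binary : ∀ s u → term w (binary s u) ≗
    term r (binary s u) ⊕ (X ⊛ (term w s ⊛ term one u) ⊕ X ⊛ (term one s ⊛ term w u))
  term-binary s u i = trans
    -- The units are written out so that each summand is a product of two weights, one of them
    -- `one`, as `term-product` expects.
    (term-split (binary s u) (w s ℕ.* 1 ℕ.+ 1 ℕ.* w u) i (trans (at-binary s u)
      (cong (r (binary s u) ℕ.+_)
        (cong₂ ℕ._+_ (sym (ℕ.*-identityʳ (w s))) (sym (ℕ.*-identityˡ (w u)))))))
    (cong (term r (binary s u) i +_) (trans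
      (cong (λ c → monomial c (size (binary s u)) i) (fromℕ-+ (w s ℕ.* 1) (1 ℕ.* w u)))
      (trans (monomial-+ (fromℕ (w s ℕ.* 1)) (fromℕ (1 ℕ.* w u)) (size (binary s u)) i)
        (cong₂ _+_ (sym (term-product w one s u i)) (sym (term-product one w s u i))))))

  -- The root contributes `r`. Every other vertex lies in the subtree of exactly one child; under a
  -- binary root the sibling subtree is then arbitrary, which gives `W ⊛ O` and `O ⊛ W`.
  gf-total-step : ∀ h → let ts = treesOfHeight≤ h ; W = Σ[ term w ] ts ; O = Σ[ term one ] ts in
    Σ[ term w ] (treesOfHeight≤ (suc h)) ≗
    Σ[ term r ] (treesOfHeight≤ (suc h)) ⊕ X ⊛ (W ⊕ (W ⊛ O ⊕ O ⊛ W))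
  gf-total-step h = begin
    Σ[ term w ] (treesOfHeight≤ (suc h))
      ≈⟨ layers (term w) h ⟩
    term w leaf ⊕ (Σ[ term w ∘ unary ] ts ⊕ Σ[ (λ l → Σ[ term w ∘ binary l ] ts) ] ts)
      ≈⟨ PS.+-cong (λ i → cong (λ c → monomial (fromℕ c) 1 i) at-leaf) (PS.+-cong
           (PS.trans (Σ-cong ts term-unary)
             (PS.trans (Σ-⊕ (term r ∘ unary) (λ s → X ⊛ term w s) ts)
               (PS.+-congˡ {Σ[ term r ∘ unary ] ts} (Σ-⊛ˡ X (term w) ts))))
           (PS.trans (Σ-cong ts (λ s → PS.trans (Σ-cong ts (term-binary s))
               (PS.trans
                 (Σ-⊕ (term r ∘ binary s)
                   (λ u → X ⊛ (term w s ⊛ term one u) ⊕ X ⊛ (term one s ⊛ term w u)) ts)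
                 (PS.+-congˡ {Σ[ term r ∘ binary s ] ts}
                   (Σ-⊕ (λ u → X ⊛ (term w s ⊛ term one u))
                        (λ u → X ⊛ (term one s ⊛ term w u)) ts)))))
             (PS.trans (Σ-⊕ (λ s → Σ[ term r ∘ binary s ] ts) (λ s → wo s ⊕ ow s) ts)
               (PS.+-congˡ {Σ[ (λ s → Σ[ term r ∘ binary s ] ts) ] ts}
                 (PS.trans (Σ-⊕ wo ow ts)
                   (PS.+-cong (Σ-term-product w one ts) (Σ-term-product one w ts))))))) ⟩
    term r leaf ⊕ ((U ⊕ X ⊛ W) ⊕ (B ⊕ (X ⊛ (W ⊛ O) ⊕ X ⊛ (O ⊛ W))))
      ≈⟨ solve 6 (λ l u b x w o →
           l :+ ((u :+ x :* w) :+ (b :+ (x :* (w :* o) :+ x :* (o :* w)))) :=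
           (l :+ (u :+ b)) :+ x :* (w :+ (w :* o :+ o :* w))) (λ _ → refl)
           (term r leaf) U B X W O ⟩
    (term r leaf ⊕ (U ⊕ B)) ⊕ X ⊛ (W ⊕ (W ⊛ O ⊕ O ⊛ W))
      ≈⟨ PS.+-congʳ {X ⊛ (W ⊕ (W ⊛ O ⊕ O ⊛ W))} (layers (term r) h) ⟨
    Σ[ term r ] (treesOfHeight≤ (suc h)) ⊕ X ⊛ (W ⊕ (W ⊛ O ⊕ O ⊛ W)) ∎
    where
    open import Relation.Binary.Reasoning.Setoid PS.setoid
    open PS-Solver
    ts = treesOfHeight≤ h
    W  = Σ[ term w ] ts
    O  = Σ[ term one ] ts
    U  = Σ[ term r ∘ unary ] ts
    B  = Σ[ (λ s → Σ[ term r ∘ binary s ] ts) ] ts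
    wo ow : MotzkinTree → PowerSeries
    wo s = Σ[ (λ u → X ⊛ (term w s ⊛ term one u)) ] ts
    ow s = Σ[ (λ u → X ⊛ (term one s ⊛ term w u)) ] ts

  gf-total : gf w ≗ gf r ⊕ X ⊛ (gf w ⊕ (gf w ⊛ gf one ⊕ gf one ⊛ gf w))
  gf-total n = trans (sym (Σ-treesOfHeight≤ w (ℕ.n≤1+n n))) (trans (gf-total-step n n)
    (cong₂ _+_ (Σ-treesOfHeight≤ r (ℕ.n≤1+n n))
      (⊛-agree n {X} {X} (λ _ _ → refl) (λ i i≤n → cong₂ _+_ (agree w i≤n)
        (cong₂ _+_ (agree-⊛ w one i≤n) (agree-⊛ one w i≤n))))))
    where
    agree : ∀ v {i} → i ≤ n → Σ[ term v ] (treesOfHeight≤ n) i ≡ gf v i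
    agree v = Σ-treesOfHeight≤ v
    agree-⊛ : ∀ u v {i} → i ≤ n → let ts = treesOfHeight≤ n in
              (Σ[ term u ] ts ⊛ Σ[ term v ] ts) i ≡ (gf u ⊛ gf v) i
    agree-⊛ u v {i} i≤n = ⊛-agree i
      (λ j j≤i → agree u (ℕ.≤-trans j≤i i≤n)) (λ j j≤i → agree v (ℕ.≤-trans j≤i i≤n))

[size≡_] : ℕ → Weight
[size≡ k ] s = if does (size s ℕ.≟ k) then 1 else 0

total-#verticesWithSubtreeSize : ∀ k → Total [size≡ k ] (#verticesWithSubtreeSize k)
total-#verticesWithSubtreeSize k = record
  { at-leaf   = trans (count-∷ leaf []) (ℕ.+-identityʳ _)
  ; at-unary  = λ s → count-∷ (unary s) (subtrees s)
  ; at-binary = λ s u → trans (count-∷ (binary s u) (subtrees s ++ subtrees u))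
      (cong ([size≡ k ] (binary s u) ℕ.+_)
        (trans (cong length (filter-++ (λ s → size s ℕ.≟ k) (subtrees s) (subtrees u)))
          (length-++ (filter (λ s → size s ℕ.≟ k) (subtrees s)))))
  }
  where
  count-∷ : ∀ s ts → length (filter (λ s → size s ℕ.≟ k) (s ∷ ts)) ≡
                     [size≡ k ] s ℕ.+ length (filter (λ s → size s ℕ.≟ k) ts)
  count-∷ s ts with does (size s ℕ.≟ k)
  ... | true  = refl
  ... | false = refl

-- Giving every vertex weight 1 makes the total number of vertices, `n Mₙ`, another instance of the
-- general equation for `Total`.
total-size : Total one size
total-size = record
  { at-leaf = refl ; at-unary = λ _ → refl ; at-binary = λ _ _ → refl }

sum-trees : ∀ w n c → (∀ s → size s ≡ n → w s ≡ c) → ℕ.sum (map w (trees n)) ≡ M n ℕ.* c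
sum-trees w n c eq = go (trees n) (λ {s} → eq s ∘ ∈-trees⁻)
  where
  go : ∀ ts → (∀ {s} → s ∈ ts → w s ≡ c) → ℕ.sum (map w ts) ≡ length ts ℕ.* c
  go []       _ = refl
  go (s ∷ ts) p = cong₂ ℕ._+_ (p (here refl)) (go ts (p ∘ there))

gf-one-M : gf one ≗ fromℕ ∘ M
gf-one-M n = cong fromℕ (trans (sum-trees one n 1 (λ _ _ → refl)) (ℕ.*-identityʳ (M n)))

gf-size : ∀ n → gf size n ≡ fromℕ (n ℕ.* M n)
gf-size n = cong fromℕ (trans (sum-trees size n n (λ _ eq → eq)) (ℕ.*-comm (M n) n))

gf-[size≡] : ∀ k → gf [size≡ k ] ≗ monomial (fromℕ (M k)) k
gf-[size≡] k n with n ℕ.≟ k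
... | yes refl = trans (cong fromℕ (trans
  (sum-trees [size≡ k ] k 1
    (λ s eq → cong (λ b → if b then 1 else 0) (dec-true (size s ℕ.≟ k) eq)))
  (ℕ.*-identityʳ (M k)))) (sym (monomial-≡ _ k))
... | no  n≢k  = trans (cong fromℕ (trans
  (sum-trees [size≡ k ] n 0
    (λ { s refl → cong (λ b → if b then 1 else 0) (dec-false (size s ℕ.≟ k) n≢k) }))
  (ℕ.*-zeroʳ (M n)))) (sym (monomial-≢ _ n≢k))

gf≥1-t : ∀ k → gf≥1 (λ n → t n k) ≗ gf (#verticesWithSubtreeSize k)
gf≥1-t k zero    = refl
gf≥1-t k (suc n) = refl

-- Algebraic relations between the generating functions

module _ where
  open PS-Solver
  open import Relation.Binary.Reasoning.Setoid PS.setoid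

  -- The scheme for all algebraic deductions below: a known equation `p ≗ q` is used with an
  -- explicit cofactor `c`, and nested uses combine several equations. What remains is a polynomial
  -- identity for the ring solver.
  linear : ∀ c l r p q → p ≗ q → l ≗ r ⊕ c ⊛ (p ⊕ ⊝ q) → l ≗ r
  linear c l r p q p≗q l≗ = begin
    l                   ≈⟨ l≗ ⟩
    r ⊕ c ⊛ (p ⊕ ⊝ q)   ≈⟨ PS.+-congˡ {r} (PS.*-congˡ {c} (PS.+-congʳ {⊝ q} p≗q)) ⟩
    r ⊕ c ⊛ (q ⊕ ⊝ q)   ≈⟨ solve 3 (λ c r q → r :+ c :* (q :- q) := r) (λ _ → refl) c r q ⟩
    r                   ∎

  -- A series with nonzero constant term has the inverse `u = 1# ⊘ h`, and
  -- `f - g = (g - f)(u h - 1) + u (f h - g h)`.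
  ⊛-cancelʳ : ∀ f g h .{{_ : NonZero (h 0)}} → f ⊛ h ≗ g ⊛ h → f ≗ g
  ⊛-cancelʳ f g h fh≗gh = linear (⊝ f ⊕ g) f g (u ⊛ h) 1# (⊘-⊛ 1# h)
    (linear u f (g ⊕ (⊝ f ⊕ g) ⊛ (u ⊛ h ⊕ ⊝ 1#)) (f ⊛ h) (g ⊛ h) fh≗gh
      (solve 4 (λ f g h u →
        f := (g :+ (:- f :+ g) :* (u :* h :- con 1ℚ)) :+ u :* (f :* h :- g :* h))
        (λ _ → refl) f g h u))
    where
    u = 1# ⊘ h

  ⊘-unique : ∀ f g h .{{_ : NonZero (h 0)}} → f ⊛ h ≗ g → f ≗ g ⊘ h
  ⊘-unique f g h fh≗g =
    ⊛-cancelʳ f (g ⊘ h) h (PS.trans fh≗g (PS.sym (⊘-⊛ g h)))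

  -- With `r = sqrt f`, equal squares give `g (g + r) = r (g + r)`, and `g + r` has constant term 2,
  -- so it can be cancelled.
  sqrt-unique : ∀ f g → g 0 ≡ 1ℚ → f 0 ≡ 1ℚ → g ⊛ g ≗ f → g ≗ sqrt f
  sqrt-unique f g g0 f0 gg≗f = ⊛-cancelʳ g r (g ⊕ r) {{nz}}
    (linear 1# (g ⊛ (g ⊕ r)) (r ⊛ (g ⊕ r)) (g ⊛ g) (r ⊛ r)
      (PS.trans gg≗f (PS.sym (sqrt-⊛ f f0)))
      (solve 2 (λ g r → g :* (g :+ r) := r :* (g :+ r) :+ con 1ℚ :* (g :* g :- r :* r))
        (λ _ → refl) g r))
    where
    r = sqrt f
    nz : NonZero ((g ⊕ r) 0)
    nz = subst (λ c → NonZero (c + 1ℚ)) (sym g0) _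

-- `C⟨x⟩` is defined by counting leaves rather than as the inverse of `Q⟨x⟩`; thus its coefficients
-- are natural numbers from the outset.
M⟨x⟩ Q⟨x⟩ C⟨x⟩ : PowerSeries
M⟨x⟩ = gf one
Q⟨x⟩ = 1# ⊕ ⊝ X ⊕ ⊝ (const (fromℕ 2) ⊛ X ⊛ M⟨x⟩)
C⟨x⟩ n = fromℕ (t (suc n) 1)

module _ where
  open PS-Solver
  open import Relation.Binary.Reasoning.Setoid PS.setoid

  -- The series `1-2x-3x²` as a polynomial in `X`, the form that the ring solver can handle.
  D : PowerSeries
  D = 1# ⊕ const (- fromℕ 2) ⊛ X ⊕ const (- fromℕ 3) ⊛ X ⊛ X

  D≗1-2x-3x² : D ≗ 1-2x-3x²
  D≗1-2x-3x² = PS.+-cong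
    (PS.+-congˡ {1#} (monomial-⊛ (- fromℕ 2) 1ℚ 0 1))
    (PS.trans (PS.*-congʳ {X} (monomial-⊛ (- fromℕ 3) 1ℚ 0 1)) (monomial-⊛ (- fromℕ 3) 1ℚ 1 1))

  -- Completing the square in `x M² + (x - 1) M + x = 0`, whose discriminant is `(1 - x)² - 4x²`.
  Q-square : Q⟨x⟩ ⊛ Q⟨x⟩ ≗ D
  Q-square = linear (const (- fromℕ 4) ⊛ X) (Q⟨x⟩ ⊛ Q⟨x⟩) D
    M⟨x⟩ (X ⊛ (1# ⊕ M⟨x⟩ ⊕ M⟨x⟩ ⊛ M⟨x⟩)) gf-one
    (solve 2 (λ x m → let q = con 1ℚ :- x :- con (fromℕ 2) :* x :* m in
        q :* q := (con 1ℚ :+ con (- fromℕ 2) :* x :+ con (- fromℕ 3) :* x :* x)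
          :+ con (- fromℕ 4) :* x :* (m :- x :* (con 1ℚ :+ m :+ m :* m)) ) (λ _ → refl) X M⟨x⟩)

  -- The equation `gf-total` is linear in `gf w`, and collecting its terms leaves the coefficient
  -- `1 - x - 2 x M`.
  total-⊛-Q : ∀ {r w} → Total r w → gf w ⊛ Q⟨x⟩ ≗ gf r
  total-⊛-Q {r} {w} total = linear 1# (gf w ⊛ Q⟨x⟩) (gf r)
    (gf w) (gf r ⊕ X ⊛ (gf w ⊕ (gf w ⊛ M⟨x⟩ ⊕ M⟨x⟩ ⊛ gf w))) (gf-total total)
    (solve 4 (λ x m w r → w :* (con 1ℚ :- x :- con (fromℕ 2) :* x :* m) :=
      r :+ con 1ℚ :* (w :- (r :+ x :* (w :+ (w :* m :+ m :* w)))))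
      (λ _ → refl) X M⟨x⟩ (gf w) (gf r))

X-⊛-zero : ∀ f → (X ⊛ f) 0 ≡ 0ℚ
X-⊛-zero f = trans (ℚ.+-identityʳ (0ℚ * f 0)) (ℚ.*-zeroˡ (f 0))

X-⊛-suc : ∀ f n → (X ⊛ f) (suc n) ≡ f n
X-⊛-suc f n = trans (cong₂ _+_ (ℚ.*-zeroˡ (f (suc n))) (⊛-identityˡ f n)) (ℚ.+-identityˡ (f n))

cX-⊛-suc : ∀ c f n → (const c ⊛ X ⊛ f) (suc n) ≡ c * f n
cX-⊛-suc c f n = trans (⊛-assoc (const c) X f (suc n))
  (trans (const-⊛ c (X ⊛ f) (suc n)) (cong (c *_) (X-⊛-suc f n)))

cXX-⊛-suc : ∀ c f n → (const c ⊛ X ⊛ (X ⊛ f)) (suc (suc n)) ≡ c * f n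
cXX-⊛-suc c f n = trans (cX-⊛-suc c (X ⊛ f) (suc n)) (cong (c *_) (X-⊛-suc f n))

monomial-⊛-+ : ∀ c k f m → (monomial c k ⊛ f) (k ℕ.+ m) ≡ c * f m
monomial-⊛-+ c zero    f m = const-⊛ c f m
monomial-⊛-+ c (suc k) f m = trans
  (cong₂ _+_ (ℚ.*-zeroˡ (f (suc k ℕ.+ m))) (monomial-⊛-+ c k f m)) (ℚ.+-identityˡ (c * f m))

-- The derivation x d/dx and the equations satisfied by `C⟨x⟩`

θ : PowerSeries → PowerSeries
θ f n = fromℕ n * f n

θ-cong : ∀ {f g} → f ≗ g → θ f ≗ θ g
θ-cong p n = cong (fromℕ n *_) (p n)

-- The Leibniz rule, by peeling the constant term of `f`; the shift costs a correction,
-- `tail (θ f) = tail f + θ (tail f)`.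
θ-⊛ : ∀ f g → θ (f ⊛ g) ≗ θ f ⊛ g ⊕ f ⊛ θ g
θ-⊛ f g zero    = solve 2 (λ a b → con 0ℚ :* (a :* b :+ con 0ℚ) :=
    (con 0ℚ :* a :* b :+ con 0ℚ) :+ (a :* (con 0ℚ :* b) :+ con 0ℚ)) refl (f 0) (g 0)
  where open Data.Rational.Solver.+-*-Solver
θ-⊛ f g (suc n) = begin
  k * (f 0 * g (suc n) + (tail f ⊛ g) n)
    ≡⟨ cong (_* (f 0 * g (suc n) + (tail f ⊛ g) n)) (fromℕ-+ 1 n) ⟩
  (1ℚ + fromℕ n) * (f 0 * g (suc n) + (tail f ⊛ g) n)
    ≡⟨ solve 4 (λ n a b c → (con 1ℚ :+ n) :* (a :* b :+ c) :=
         (con 1ℚ :+ n) :* (a :* b) :+ (c :+ n :* c)) refl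
         (fromℕ n) (f 0) (g (suc n)) ((tail f ⊛ g) n) ⟩
  (1ℚ + fromℕ n) * (f 0 * g (suc n)) + ((tail f ⊛ g) n + θ (tail f ⊛ g) n)
    ≡⟨ cong (λ c → (1ℚ + fromℕ n) * (f 0 * g (suc n)) + ((tail f ⊛ g) n + c)) (θ-⊛ (tail f) g n) ⟩
  (1ℚ + fromℕ n) * (f 0 * g (suc n)) +
    ((tail f ⊛ g) n + ((θ (tail f) ⊛ g) n + (tail f ⊛ θ g) n))
    ≡⟨ solve 6 (λ n a b c d e → (con 1ℚ :+ n) :* (a :* b) :+ (c :+ (d :+ e)) :=
         (con 0ℚ :* a :* b :+ (c :+ d)) :+ (a :* ((con 1ℚ :+ n) :* b) :+ e)) refl
         (fromℕ n) (f 0) (g (suc n)) ((tail f ⊛ g) n) ((θ (tail f) ⊛ g) n) ((tail f ⊛ θ g) n) ⟩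
  (0ℚ * f 0 * g (suc n) + ((tail f ⊛ g) n + (θ (tail f) ⊛ g) n)) +
    (f 0 * ((1ℚ + fromℕ n) * g (suc n)) + (tail f ⊛ θ g) n)
    ≡⟨ cong₂ (λ c d → (0ℚ * f 0 * g (suc n) + c) + (f 0 * (d * g (suc n)) + (tail f ⊛ θ g) n))
         (trans (sym (⊛-distribʳ g (tail f) (θ (tail f)) n))
           (PS.*-congʳ {g} tail-θ n))
         (sym (fromℕ-+ 1 n)) ⟩
  (0ℚ * f 0 * g (suc n) + (tail (θ f) ⊛ g) n) + (f 0 * θ g (suc n) + (tail f ⊛ θ g) n) ∎
  where
  open ≡-Reasoning
  open Data.Rational.Solver.+-*-Solver
  k = fromℕ (suc n)
  tail-θ : tail f ⊕ θ (tail f) ≗ tail (θ f)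
  tail-θ i = trans (solve 2 (λ a n → a :+ n :* a := (con 1ℚ :+ n) :* a) refl (f (suc i)) (fromℕ i))
    (cong (_* f (suc i)) (sym (fromℕ-+ 1 i)))

θ-D : θ D ≗ const (- fromℕ 2) ⊛ X ⊕ const (- fromℕ 6) ⊛ X ⊛ X
θ-D n = trans (θ-cong D≗1-2x-3x² n) (trans (go n) (sym (PS.+-cong
  (monomial-⊛ (- fromℕ 2) 1ℚ 0 1)
  (PS.trans (PS.*-congʳ {X} (monomial-⊛ (- fromℕ 6) 1ℚ 0 1)) (monomial-⊛ (- fromℕ 6) 1ℚ 1 1)) n)))
  where
  go : θ 1-2x-3x² ≗ monomial (- fromℕ 2) 1 ⊕ monomial (- fromℕ 6) 2
  go 0 = refl
  go 1 = refl
  go 2 = refl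
  go (suc (suc (suc n))) = ℚ.*-zeroʳ (fromℕ (3 ℕ.+ n))

C-⊛-Q : C⟨x⟩ ⊛ Q⟨x⟩ ≗ 1#
C-⊛-Q n = begin
  (C⟨x⟩ ⊛ Q⟨x⟩) n                          ≡⟨ X-⊛-suc (C⟨x⟩ ⊛ Q⟨x⟩) n ⟨
  (X ⊛ (C⟨x⟩ ⊛ Q⟨x⟩)) (suc n)              ≡⟨ ⊛-assoc X C⟨x⟩ Q⟨x⟩ (suc n) ⟨
  (X ⊛ C⟨x⟩ ⊛ Q⟨x⟩) (suc n)                ≡⟨ PS.*-congʳ {Q⟨x⟩} XC (suc n) ⟩
  (gf (#verticesWithSubtreeSize 1) ⊛ Q⟨x⟩) (suc n)
    ≡⟨ total-⊛-Q (total-#verticesWithSubtreeSize 1) (suc n) ⟩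
  -- `M 1` computes to 1, so the right side is coefficient `suc n` of `x`, which reduces to
  -- coefficient `n` of `1#`.
  gf [size≡ 1 ] (suc n)                ≡⟨ gf-[size≡] 1 (suc n) ⟩
  1# n                                 ∎
  where
  open ≡-Reasoning
  XC : X ⊛ C⟨x⟩ ≗ gf (#verticesWithSubtreeSize 1)
  XC zero    = X-⊛-zero C⟨x⟩
  XC (suc n) = X-⊛-suc C⟨x⟩ n

module _ where
  open PS-Solver

  div-Q : ∀ f g → f ⊛ Q⟨x⟩ ≗ g → f ≗ g ⊛ C⟨x⟩
  div-Q f g eq = linear C⟨x⟩ f (g ⊛ C⟨x⟩) (f ⊛ Q⟨x⟩) g eq
    (linear (⊝ f) f (g ⊛ C⟨x⟩ ⊕ C⟨x⟩ ⊛ (f ⊛ Q⟨x⟩ ⊕ ⊝ g)) (C⟨x⟩ ⊛ Q⟨x⟩) 1# C-⊛-Q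
      (solve 4 (λ f g c q → f := (g :* c :+ c :* (f :* q :- g)) :+ (:- f) :* (c :* q :- con 1ℚ))
        (λ _ → refl) f g C⟨x⟩ Q⟨x⟩))

  -- Here `gf size = M C`, and `2 x M = 1 - x - Q` together with `C Q = 1` gives
  -- `2 x M C = C - x C - 1`.
  gf-size-equation : const (fromℕ 2) ⊛ X ⊛ gf size ⊕ X ⊛ C⟨x⟩ ⊕ 1# ≗ C⟨x⟩
  gf-size-equation = linear (const (fromℕ 2) ⊛ X) lhs C⟨x⟩ (gf size) (M⟨x⟩ ⊛ C⟨x⟩)
    (div-Q (gf size) M⟨x⟩ (total-⊛-Q total-size))
    (linear (⊝ 1#) lhs (C⟨x⟩ ⊕ const (fromℕ 2) ⊛ X ⊛ (gf size ⊕ ⊝ (M⟨x⟩ ⊛ C⟨x⟩)))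
      (C⟨x⟩ ⊛ Q⟨x⟩) 1# C-⊛-Q
      (solve 4 (λ x w c m → con (fromℕ 2) :* x :* w :+ x :* c :+ con 1ℚ :=
        (c :+ con (fromℕ 2) :* x :* (w :- m :* c)) :+ (:- con 1ℚ) :*
          (c :* (con 1ℚ :- x :- con (fromℕ 2) :* x :* m) :- con 1ℚ))
        (λ _ → refl) X (gf size) C⟨x⟩ M⟨x⟩))
    where
    lhs = const (fromℕ 2) ⊛ X ⊛ gf size ⊕ X ⊛ C⟨x⟩ ⊕ 1#

  -- From `Q² = D` and `C Q = 1` follows `Q = C D`. Terms are moved to the side where their sign is
  -- positive, so that coefficients can be compared in `ℕ`.
  M-equation : const (fromℕ 2) ⊛ X ⊛ M⟨x⟩ ⊕ C⟨x⟩ ⊕ X ≗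
               1# ⊕ const (fromℕ 2) ⊛ X ⊛ C⟨x⟩ ⊕ const (fromℕ 3) ⊛ X ⊛ (X ⊛ C⟨x⟩)
  M-equation = linear Q⟨x⟩ lhs rhs (C⟨x⟩ ⊛ Q⟨x⟩) 1# C-⊛-Q
    (linear (⊝ C⟨x⟩) lhs (rhs ⊕ Q⟨x⟩ ⊛ (C⟨x⟩ ⊛ Q⟨x⟩ ⊕ ⊝ 1#)) (Q⟨x⟩ ⊛ Q⟨x⟩) D Q-square
      (solve 3 (λ x c m → let q = con 1ℚ :- x :- con (fromℕ 2) :* x :* m in
        con (fromℕ 2) :* x :* m :+ c :+ x :=
        (con 1ℚ :+ con (fromℕ 2) :* x :* c :+ con (fromℕ 3) :* x :* (x :* c) :+
          q :* (c :* q :- con 1ℚ)) :+ (:- c) :*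
          (q :* q :- (con 1ℚ :+ con (- fromℕ 2) :* x :+ con (- fromℕ 3) :* x :* x)))
        (λ _ → refl) X C⟨x⟩ M⟨x⟩))
    where
    lhs = const (fromℕ 2) ⊛ X ⊛ M⟨x⟩ ⊕ C⟨x⟩ ⊕ X
    rhs = 1# ⊕ const (fromℕ 2) ⊛ X ⊛ C⟨x⟩ ⊕ const (fromℕ 3) ⊛ X ⊛ (X ⊛ C⟨x⟩)

  -- Differentiating `C Q = 1` and `Q² = D` gives `D θC = Q² θC = - C Q θQ = - ½ C θD = (x + 3x²)
  -- C`.
  C-equation : θ C⟨x⟩ ≗ const (fromℕ 2) ⊛ X ⊛ θ C⟨x⟩ ⊕ const (fromℕ 3) ⊛ X ⊛ (X ⊛ θ C⟨x⟩)
                      ⊕ X ⊛ C⟨x⟩ ⊕ const (fromℕ 3) ⊛ X ⊛ (X ⊛ C⟨x⟩)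
  C-equation = linear (⊝ θ C⟨x⟩) (θ C⟨x⟩) rhs (Q⟨x⟩ ⊛ Q⟨x⟩) D Q-square
    (linear Q⟨x⟩ (θ C⟨x⟩) rhs₁ (θ C⟨x⟩ ⊛ Q⟨x⟩ ⊕ C⟨x⟩ ⊛ θ Q⟨x⟩) (const 0ℚ) θ-CQ
    (linear (const (- ½) ⊛ C⟨x⟩) (θ C⟨x⟩)
      (rhs₁ ⊕ Q⟨x⟩ ⊛ (θ C⟨x⟩ ⊛ Q⟨x⟩ ⊕ C⟨x⟩ ⊛ θ Q⟨x⟩ ⊕ ⊝ const 0ℚ))
      (θ Q⟨x⟩ ⊛ Q⟨x⟩ ⊕ Q⟨x⟩ ⊛ θ Q⟨x⟩) (const (- fromℕ 2) ⊛ X ⊕ const (- fromℕ 6) ⊛ X ⊛ X) θ-QQ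
      (solve 5 (λ x c q c′ q′ → c′ := con (fromℕ 2) :* x :* c′ :+ con (fromℕ 3) :* x :* (x :* c′)
          :+ x :* c :+ con (fromℕ 3) :* x :* (x :* c)
        :+ (:- c′) :* (q :* q :- (con 1ℚ :+ con (- fromℕ 2) :* x :+ con (- fromℕ 3) :* x :* x))
        :+ q :* (c′ :* q :+ c :* q′ :- con 0ℚ)
        :+ con (- ½) :* c :*
             (q′ :* q :+ q :* q′ :- (con (- fromℕ 2) :* x :+ con (- fromℕ 6) :* x :* x)))
        (λ _ → refl) X C⟨x⟩ Q⟨x⟩ (θ C⟨x⟩) (θ Q⟨x⟩))))
    where
    rhs = const (fromℕ 2) ⊛ X ⊛ θ C⟨x⟩ ⊕ const (fromℕ 3) ⊛ X ⊛ (X ⊛ θ C⟨x⟩)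
          ⊕ X ⊛ C⟨x⟩ ⊕ const (fromℕ 3) ⊛ X ⊛ (X ⊛ C⟨x⟩)
    rhs₁ = rhs ⊕ (⊝ θ C⟨x⟩) ⊛ (Q⟨x⟩ ⊛ Q⟨x⟩ ⊕ ⊝ D)
    θ-CQ : θ C⟨x⟩ ⊛ Q⟨x⟩ ⊕ C⟨x⟩ ⊛ θ Q⟨x⟩ ≗ const 0ℚ
    θ-CQ = PS.trans (PS.sym (θ-⊛ C⟨x⟩ Q⟨x⟩)) (PS.trans (θ-cong C-⊛-Q)
      λ { zero → refl ; (suc n) → ℚ.*-zeroʳ (fromℕ (suc n)) })
    θ-QQ : θ Q⟨x⟩ ⊛ Q⟨x⟩ ⊕ Q⟨x⟩ ⊛ θ Q⟨x⟩ ≗ const (- fromℕ 2) ⊛ X ⊕ const (- fromℕ 6) ⊛ X ⊛ X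
    θ-QQ = PS.trans (PS.sym (θ-⊛ Q⟨x⟩ Q⟨x⟩)) (PS.trans (θ-cong Q-square) θ-D)

t-equation : ∀ k → gf (#verticesWithSubtreeSize k) ⊛ Q⟨x⟩ ≗ monomial (fromℕ (M k)) k
t-equation k = PS.trans (total-⊛-Q (total-#verticesWithSubtreeSize k)) (gf-[size≡] k)

Q≗sqrt : Q⟨x⟩ ≗ sqrt 1-2x-3x²
Q≗sqrt = sqrt-unique 1-2x-3x² Q⟨x⟩ refl refl (PS.trans Q-square D≗1-2x-3x²)

gf≥1-t-⊘ : ∀ k → gf≥1 (λ n → t n k) ≗ monomial (fromℕ (M k)) k ⊘ sqrt 1-2x-3x²
gf≥1-t-⊘ k = ⊘-unique (gf≥1 (λ n → t n k)) (monomial (fromℕ (M k)) k) (sqrt 1-2x-3x²)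
  (PS.trans (⊛-cong (gf≥1-t k) (PS.sym Q≗sqrt)) (t-equation k))

-- Recurrences and bounds for the coefficients

fromℕ-injective : ∀ {m n} → fromℕ m ≡ fromℕ n → m ≡ n
fromℕ-injective {m} {n} eq with ℚᵘ.*≡* p ← ℚᵘ.≃-trans (ℚᵘ.≃-sym (toℚᵘ-fromℕ m))
    (ℚᵘ.≃-trans (ℚ.toℚᵘ-cong eq) (toℚᵘ-fromℕ n)) =
  ℤ.+-injective (trans (sym (ℤ.*-identityʳ (ℤ.+ m))) (trans p (ℤ.*-identityʳ (ℤ.+ n))))

C : ℕ → ℕ
C n = t (suc n) 1

-- Combinatorially, a tree with a marked subtree of size `k` is a tree with `suc m` vertices and a
-- marked leaf, the leaf being replaced by any of the `M k` trees. The proof reads this off from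
-- `Mₖ xᵏ C`.
t-C : ∀ k m → t (k ℕ.+ m) k ≡ M k ℕ.* C m
t-C k m = fromℕ-injective (trans
  (div-Q (gf (#verticesWithSubtreeSize k)) (monomial (fromℕ (M k)) k) (t-equation k) (k ℕ.+ m))
  (trans (monomial-⊛-+ (fromℕ (M k)) k C⟨x⟩ m) (sym (fromℕ-* (M k) (C m)))))

C-suc : ∀ n → 2 ℕ.* (n ℕ.* M n) ℕ.+ C n ≡ C (suc n)
C-suc n = fromℕ-injective (begin
  fromℕ (2 ℕ.* (n ℕ.* M n) ℕ.+ C n)
    ≡⟨ fromℕ-+ (2 ℕ.* (n ℕ.* M n)) (C n) ⟩
  fromℕ (2 ℕ.* (n ℕ.* M n)) + C⟨x⟩ n
    ≡⟨ cong (_+ C⟨x⟩ n) (fromℕ-* 2 (n ℕ.* M n)) ⟩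
  fromℕ 2 * fromℕ (n ℕ.* M n) + C⟨x⟩ n
    ≡⟨ cong (λ w → fromℕ 2 * w + C⟨x⟩ n) (gf-size n) ⟨
  fromℕ 2 * gf size n + C⟨x⟩ n
    ≡⟨ cong₂ _+_ (cX-⊛-suc (fromℕ 2) (gf size) n) (X-⊛-suc C⟨x⟩ n) ⟨
  (const (fromℕ 2) ⊛ X ⊛ gf size) (suc n) + (X ⊛ C⟨x⟩) (suc n)
    ≡⟨ ℚ.+-identityʳ _ ⟨
  (const (fromℕ 2) ⊛ X ⊛ gf size) (suc n) + (X ⊛ C⟨x⟩) (suc n) + 0ℚ
    ≡⟨ gf-size-equation (suc n) ⟩
  C⟨x⟩ (suc n) ∎)
  where open ≡-Reasoning

M-suc : ∀ n → 2 ℕ.* M (suc n) ℕ.+ C (2 ℕ.+ n) ≡ 2 ℕ.* C (suc n) ℕ.+ 3 ℕ.* C n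
M-suc n = fromℕ-injective (begin
  fromℕ (2 ℕ.* M (suc n) ℕ.+ C (2 ℕ.+ n))
    ≡⟨ fromℕ-+ (2 ℕ.* M (suc n)) (C (2 ℕ.+ n)) ⟩
  fromℕ (2 ℕ.* M (suc n)) + C⟨x⟩ (2 ℕ.+ n)
    ≡⟨ cong (_+ C⟨x⟩ (2 ℕ.+ n)) (fromℕ-* 2 (M (suc n))) ⟩
  fromℕ 2 * fromℕ (M (suc n)) + C⟨x⟩ (2 ℕ.+ n)
    ≡⟨ cong (λ m → fromℕ 2 * m + C⟨x⟩ (2 ℕ.+ n)) (gf-one-M (suc n)) ⟨
  fromℕ 2 * M⟨x⟩ (suc n) + C⟨x⟩ (2 ℕ.+ n)
    ≡⟨ cong (_+ C⟨x⟩ (2 ℕ.+ n)) (cX-⊛-suc (fromℕ 2) M⟨x⟩ (suc n)) ⟨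
  (const (fromℕ 2) ⊛ X ⊛ M⟨x⟩) (2 ℕ.+ n) + C⟨x⟩ (2 ℕ.+ n)
    ≡⟨ ℚ.+-identityʳ _ ⟨
  (const (fromℕ 2) ⊛ X ⊛ M⟨x⟩) (2 ℕ.+ n) + C⟨x⟩ (2 ℕ.+ n) + 0ℚ
    ≡⟨ M-equation (2 ℕ.+ n) ⟩
  0ℚ + (const (fromℕ 2) ⊛ X ⊛ C⟨x⟩) (2 ℕ.+ n) + (const (fromℕ 3) ⊛ X ⊛ (X ⊛ C⟨x⟩)) (2 ℕ.+ n)
    ≡⟨ cong₂ _+_ (trans (ℚ.+-identityˡ _) (cX-⊛-suc (fromℕ 2) C⟨x⟩ (suc n)))
                 (cXX-⊛-suc (fromℕ 3) C⟨x⟩ n) ⟩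
  fromℕ 2 * C⟨x⟩ (suc n) + fromℕ 3 * C⟨x⟩ n
    ≡⟨ cong₂ _+_ (fromℕ-* 2 (C (suc n))) (fromℕ-* 3 (C n)) ⟨
  fromℕ (2 ℕ.* C (suc n)) + fromℕ (3 ℕ.* C n)
    ≡⟨ fromℕ-+ (2 ℕ.* C (suc n)) (3 ℕ.* C n) ⟨
  fromℕ (2 ℕ.* C (suc n) ℕ.+ 3 ℕ.* C n) ∎)
  where open ≡-Reasoning

C-recurrence : ∀ n → (2 ℕ.+ n) ℕ.* C (2 ℕ.+ n) ≡
  2 ℕ.* (suc n ℕ.* C (suc n)) ℕ.+ 3 ℕ.* (n ℕ.* C n) ℕ.+ C (suc n) ℕ.+ 3 ℕ.* C n
C-recurrence n = fromℕ-injective (begin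
  fromℕ ((2 ℕ.+ n) ℕ.* C (2 ℕ.+ n))
    ≡⟨ fromℕ-* (2 ℕ.+ n) (C (2 ℕ.+ n)) ⟩
  θ C⟨x⟩ (2 ℕ.+ n)
    ≡⟨ C-equation (2 ℕ.+ n) ⟩
  (const (fromℕ 2) ⊛ X ⊛ θ C⟨x⟩) (2 ℕ.+ n) + (const (fromℕ 3) ⊛ X ⊛ (X ⊛ θ C⟨x⟩)) (2 ℕ.+ n)
    + (X ⊛ C⟨x⟩) (2 ℕ.+ n) + (const (fromℕ 3) ⊛ X ⊛ (X ⊛ C⟨x⟩)) (2 ℕ.+ n)
    ≡⟨ cong₂ _+_ (cong₂ _+_ (cong₂ _+_
         (trans (cX-⊛-suc (fromℕ 2) (θ C⟨x⟩) (suc n))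
           (trans (cong (fromℕ 2 *_) (sym (fromℕ-* (suc n) (C (suc n)))))
             (sym (fromℕ-* 2 (suc n ℕ.* C (suc n))))))
         (trans (cXX-⊛-suc (fromℕ 3) (θ C⟨x⟩) n)
           (trans (cong (fromℕ 3 *_) (sym (fromℕ-* n (C n)))) (sym (fromℕ-* 3 (n ℕ.* C n))))))
         (X-⊛-suc C⟨x⟩ (suc n)))
         (trans (cXX-⊛-suc (fromℕ 3) C⟨x⟩ n) (sym (fromℕ-* 3 (C n)))) ⟩
  fromℕ a + fromℕ b + fromℕ (C (suc n)) + fromℕ (3 ℕ.* C n)
    ≡⟨ cong (λ s → s + fromℕ (C (suc n)) + fromℕ (3 ℕ.* C n)) (fromℕ-+ a b) ⟨
  fromℕ (a ℕ.+ b) + fromℕ (C (suc n)) + fromℕ (3 ℕ.* C n)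
    ≡⟨ cong (_+ fromℕ (3 ℕ.* C n)) (fromℕ-+ (a ℕ.+ b) (C (suc n))) ⟨
  fromℕ (a ℕ.+ b ℕ.+ C (suc n)) + fromℕ (3 ℕ.* C n)
    ≡⟨ fromℕ-+ (a ℕ.+ b ℕ.+ C (suc n)) (3 ℕ.* C n) ⟨
  fromℕ (a ℕ.+ b ℕ.+ C (suc n) ℕ.+ 3 ℕ.* C n) ∎)
  where
  open ≡-Reasoning
  a = 2 ℕ.* (suc n ℕ.* C (suc n))
  b = 3 ℕ.* (n ℕ.* C n)

-- Inequalities that follow from the three-term recurrence

module Recurrence (c : ℕ → ℕ) (c₀ : c 0 ≡ 1) (c₁ : c 1 ≡ 1) (c₂ : c 2 ≡ 3)
  (recurrence : ∀ n → (2 ℕ.+ n) ℕ.* c (2 ℕ.+ n) ≡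
                2 ℕ.* (suc n ℕ.* c (suc n)) ℕ.+ 3 ℕ.* (n ℕ.* c n) ℕ.+ c (suc n) ℕ.+ 3 ℕ.* c n) where
  open Data.Nat.Solver.+-*-Solver
  open ℕ.≤-Reasoning

  -- The two bounds are proved together because the recurrence exchanges them: the lower bound on
  -- one ratio yields the upper bound on the next, and conversely.
  bounds : ∀ n → c (suc n) ≤ 3 ℕ.* c n × suc (3 ℕ.* n) ℕ.* c n ≤ suc n ℕ.* c (suc n)
  bounds zero rewrite c₀ | c₁ = s≤s z≤n , s≤s z≤n
  bounds (suc n) with bounds n
  -- The factor `2 + n` makes the recurrence applicable, and `1 + 3 n` turns the contribution of `w`
  -- into a multiple of the left side of `lower`. The slack is then exactly `4 n x`.
  ... | upper , lower = ℕ.*-cancelˡ-≤ (suc (3 ℕ.* n) ℕ.* (2 ℕ.+ n)) (begin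
    suc (3 ℕ.* n) ℕ.* (2 ℕ.+ n) ℕ.* y
      ≡⟨ ℕ.*-assoc (suc (3 ℕ.* n)) (2 ℕ.+ n) y ⟩
    suc (3 ℕ.* n) ℕ.* ((2 ℕ.+ n) ℕ.* y)
      ≡⟨ cong (suc (3 ℕ.* n) ℕ.*_) (recurrence n) ⟩
    suc (3 ℕ.* n) ℕ.* (2 ℕ.* (suc n ℕ.* x) ℕ.+ 3 ℕ.* (n ℕ.* w) ℕ.+ x ℕ.+ 3 ℕ.* w)
      ≡⟨ solve 3 (λ n w x → (con 1 :+ con 3 :* n) :*
             (con 2 :* ((con 1 :+ n) :* x) :+ con 3 :* (n :* w) :+ x :+ con 3 :* w) :=
             (con 1 :+ con 3 :* n) :* (con 2 :* n :+ con 3) :* x :+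
             con 3 :* (con 1 :+ n) :* ((con 1 :+ con 3 :* n) :* w)) refl n w x ⟩
    suc (3 ℕ.* n) ℕ.* (2 ℕ.* n ℕ.+ 3) ℕ.* x ℕ.+ 3 ℕ.* suc n ℕ.* (suc (3 ℕ.* n) ℕ.* w)
      ≤⟨ ℕ.+-monoʳ-≤ (suc (3 ℕ.* n) ℕ.* (2 ℕ.* n ℕ.+ 3) ℕ.* x) (ℕ.*-monoʳ-≤ (3 ℕ.* suc n) lower) ⟩
    suc (3 ℕ.* n) ℕ.* (2 ℕ.* n ℕ.+ 3) ℕ.* x ℕ.+ 3 ℕ.* suc n ℕ.* (suc n ℕ.* x)
      ≤⟨ ℕ.m≤m+n _ (4 ℕ.* n ℕ.* x) ⟩
    suc (3 ℕ.* n) ℕ.* (2 ℕ.* n ℕ.+ 3) ℕ.* x ℕ.+ 3 ℕ.* suc n ℕ.* (suc n ℕ.* x) ℕ.+ 4 ℕ.* n ℕ.* x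
      ≡⟨ solve 2 (λ n x → (con 1 :+ con 3 :* n) :* (con 2 :* n :+ con 3) :* x :+
             con 3 :* (con 1 :+ n) :* ((con 1 :+ n) :* x) :+ con 4 :* n :* x :=
             (con 1 :+ con 3 :* n) :* (con 2 :+ n) :* (con 3 :* x)) refl n x ⟩
    suc (3 ℕ.* n) ℕ.* (2 ℕ.+ n) ℕ.* (3 ℕ.* x) ∎)
    , (begin
    suc (3 ℕ.* suc n) ℕ.* x
      ≡⟨ solve 2 (λ n x → (con 1 :+ con 3 :* (con 1 :+ n)) :* x :=
           con 2 :* ((con 1 :+ n) :* x) :+ x :+ (con 1 :+ n) :* x) refl n x ⟩
    2 ℕ.* (suc n ℕ.* x) ℕ.+ x ℕ.+ suc n ℕ.* x
      ≤⟨ ℕ.+-monoʳ-≤ (2 ℕ.* (suc n ℕ.* x) ℕ.+ x) (ℕ.*-monoʳ-≤ (suc n) upper) ⟩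
    2 ℕ.* (suc n ℕ.* x) ℕ.+ x ℕ.+ suc n ℕ.* (3 ℕ.* w)
      ≡⟨ solve 3 (λ n w x → con 2 :* ((con 1 :+ n) :* x) :+ x :+ (con 1 :+ n) :* (con 3 :* w) :=
           con 2 :* ((con 1 :+ n) :* x) :+ con 3 :* (n :* w) :+ x :+ con 3 :* w) refl n w x ⟩
    2 ℕ.* (suc n ℕ.* x) ℕ.+ 3 ℕ.* (n ℕ.* w) ℕ.+ x ℕ.+ 3 ℕ.* w
      ≡⟨ recurrence n ⟨
    (2 ℕ.+ n) ℕ.* y ∎)
    where
    w = c n
    x = c (suc n)
    y = c (2 ℕ.+ n)

  ratio-upper : ∀ n → c (suc n) ≤ 3 ℕ.* c n
  ratio-upper n = proj₁ (bounds n)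

  ratio-lower : ∀ n → suc (3 ℕ.* n) ℕ.* c n ≤ suc n ℕ.* c (suc n)
  ratio-lower n = proj₂ (bounds n)

  -- With `n = 3 + m` this says that the ratio ending at `n` is at most `3 - 1/n`, again by feeding
  -- `ratio-lower` into the recurrence. It fails at `n = 2`, where the ratio is 3; hence the shift.
  ratio-upper-sharp : ∀ m → (3 ℕ.+ m) ℕ.* c (3 ℕ.+ m) ≤ (3 ℕ.* m ℕ.+ 8) ℕ.* c (2 ℕ.+ m)
  ratio-upper-sharp m = ℕ.*-cancelˡ-≤ (4 ℕ.+ 3 ℕ.* m) (begin
    (4 ℕ.+ 3 ℕ.* m) ℕ.* ((3 ℕ.+ m) ℕ.* c (3 ℕ.+ m))
      ≡⟨ cong ((4 ℕ.+ 3 ℕ.* m) ℕ.*_) (recurrence (suc m)) ⟩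
    (4 ℕ.+ 3 ℕ.* m) ℕ.* (2 ℕ.* ((2 ℕ.+ m) ℕ.* y) ℕ.+ 3 ℕ.* (suc m ℕ.* x) ℕ.+ y ℕ.+ 3 ℕ.* x)
      ≡⟨ solve 3 (λ m x y → (con 4 :+ con 3 :* m) :*
           (con 2 :* ((con 2 :+ m) :* y) :+ con 3 :* ((con 1 :+ m) :* x) :+ y :+ con 3 :* x) :=
           (con 4 :+ con 3 :* m) :* (con 2 :* m :+ con 5) :* y :+
           con 3 :* (con 2 :+ m) :* ((con 1 :+ con 3 :* (con 1 :+ m)) :* x)) refl m x y ⟩
    (4 ℕ.+ 3 ℕ.* m) ℕ.* (2 ℕ.* m ℕ.+ 5) ℕ.* y ℕ.+ 3 ℕ.* (2 ℕ.+ m) ℕ.* (suc (3 ℕ.* suc m) ℕ.* x)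
      ≤⟨ ℕ.+-monoʳ-≤ ((4 ℕ.+ 3 ℕ.* m) ℕ.* (2 ℕ.* m ℕ.+ 5) ℕ.* y)
           (ℕ.*-monoʳ-≤ (3 ℕ.* (2 ℕ.+ m)) (ratio-lower (suc m))) ⟩
    (4 ℕ.+ 3 ℕ.* m) ℕ.* (2 ℕ.* m ℕ.+ 5) ℕ.* y ℕ.+ 3 ℕ.* (2 ℕ.+ m) ℕ.* ((2 ℕ.+ m) ℕ.* y)
      ≤⟨ ℕ.m≤m+n _ (m ℕ.* y) ⟩
    (4 ℕ.+ 3 ℕ.* m) ℕ.* (2 ℕ.* m ℕ.+ 5) ℕ.* y ℕ.+ 3 ℕ.* (2 ℕ.+ m) ℕ.* ((2 ℕ.+ m) ℕ.* y) ℕ.+ m ℕ.* y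
      ≡⟨ solve 2 (λ m y → (con 4 :+ con 3 :* m) :* (con 2 :* m :+ con 5) :* y :+
           con 3 :* (con 2 :+ m) :* ((con 2 :+ m) :* y) :+ m :* y :=
           (con 4 :+ con 3 :* m) :* ((con 3 :* m :+ con 8) :* y)) refl m y ⟩
    (4 ℕ.+ 3 ℕ.* m) ℕ.* ((3 ℕ.* m ℕ.+ 8) ℕ.* y) ∎)
    where
    x = c (1 ℕ.+ m)
    y = c (2 ℕ.+ m)

  -- Since (1 − 1/(3m))³ ≤ m/(m+1), ratio-upper-sharp gives the decay of (c n / 3ⁿ)³.
  growth : ∀ n → suc n ℕ.* c n ℕ.^ 3 ≤ 27 ℕ.^ n
  growth 0 rewrite c₀ = ℕ.≤-refl
  growth 1 rewrite c₁ = ℕ.m≤m+n 2 25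
  growth 2 rewrite c₂ = ℕ.m≤m+n 81 648
  growth (suc (suc (suc m))) = ℕ.*-cancelˡ-≤ (n ℕ.^ 3) {{ℕ.m^n≢0 n 3}} (begin
    n ℕ.^ 3 ℕ.* (suc n ℕ.* c n ℕ.^ 3)
      ≡⟨ solve 2 (λ n z → n :^ 3 :* ((con 1 :+ n) :* z :^ 3) :=
           (con 1 :+ n) :* (n :* z) :^ 3) refl n (c n) ⟩
    suc n ℕ.* (n ℕ.* c n) ℕ.^ 3
      ≤⟨ ℕ.*-monoʳ-≤ (suc n) (ℕ.^-monoˡ-≤ 3 (ratio-upper-sharp m)) ⟩
    suc n ℕ.* ((3 ℕ.* m ℕ.+ 8) ℕ.* y) ℕ.^ 3
      ≤⟨ ℕ.m≤m+n _ ((18 ℕ.* m ℕ.* m ℕ.+ 100 ℕ.* m ℕ.+ 139) ℕ.* y ℕ.^ 3) ⟩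
    suc n ℕ.* ((3 ℕ.* m ℕ.+ 8) ℕ.* y) ℕ.^ 3 ℕ.+ (18 ℕ.* m ℕ.* m ℕ.+ 100 ℕ.* m ℕ.+ 139) ℕ.* y ℕ.^ 3
      ≡⟨ solve 2 (λ m y → (con 4 :+ m) :* ((con 3 :* m :+ con 8) :* y) :^ 3 :+
             (con 18 :* m :* m :+ con 100 :* m :+ con 139) :* y :^ 3 :=
             (con 3 :+ m) :^ 3 :* (con 27 :* ((con 3 :+ m) :* y :^ 3))) refl m y ⟩
    n ℕ.^ 3 ℕ.* (27 ℕ.* (n ℕ.* y ℕ.^ 3))
      ≤⟨ ℕ.*-monoʳ-≤ (n ℕ.^ 3) (ℕ.*-monoʳ-≤ 27 (growth (suc (suc m)))) ⟩
    n ℕ.^ 3 ℕ.* 27 ℕ.^ n ∎)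
    where
    n = 3 ℕ.+ m
    y = c (2 ℕ.+ m)

  -- By `ratio-upper`, `c m / 3ᵐ` is nonincreasing.
  shift-upper : ∀ m k → c (k ℕ.+ m) ≤ 3 ℕ.^ k ℕ.* c m
  shift-upper m zero    = ℕ.≤-reflexive (sym (ℕ.*-identityˡ (c m)))
  shift-upper m (suc k) = begin
    c (suc (k ℕ.+ m))          ≤⟨ ratio-upper (k ℕ.+ m) ⟩
    3 ℕ.* c (k ℕ.+ m)          ≤⟨ ℕ.*-monoʳ-≤ 3 (shift-upper m k) ⟩
    3 ℕ.* (3 ℕ.^ k ℕ.* c m)    ≡⟨ ℕ.*-assoc 3 (3 ℕ.^ k) (c m) ⟨
    3 ℕ.^ suc k ℕ.* c m        ∎

  -- By `ratio-lower`, weakened from `3 m + 1` to `3 m`, the quantity `m c m / 3ᵐ` is nondecreasing.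
  shift-lower : ∀ m k → 3 ℕ.^ k ℕ.* (m ℕ.* c m) ≤ (k ℕ.+ m) ℕ.* c (k ℕ.+ m)
  shift-lower m zero    = ℕ.≤-reflexive (ℕ.*-identityˡ (m ℕ.* c m))
  shift-lower m (suc k) = begin
    3 ℕ.^ suc k ℕ.* (m ℕ.* c m)               ≡⟨ ℕ.*-assoc 3 (3 ℕ.^ k) (m ℕ.* c m) ⟩
    3 ℕ.* (3 ℕ.^ k ℕ.* (m ℕ.* c m))           ≤⟨ ℕ.*-monoʳ-≤ 3 (shift-lower m k) ⟩
    3 ℕ.* ((k ℕ.+ m) ℕ.* c (k ℕ.+ m))         ≡⟨ ℕ.*-assoc 3 (k ℕ.+ m) (c (k ℕ.+ m)) ⟨
    3 ℕ.* (k ℕ.+ m) ℕ.* c (k ℕ.+ m)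
      ≤⟨ ℕ.*-monoˡ-≤ (c (k ℕ.+ m)) (ℕ.n≤1+n (3 ℕ.* (k ℕ.+ m))) ⟩
    suc (3 ℕ.* (k ℕ.+ m)) ℕ.* c (k ℕ.+ m)     ≤⟨ ratio-lower (k ℕ.+ m) ⟩
    suc (k ℕ.+ m) ℕ.* c (suc (k ℕ.+ m))     ∎

-- The three initial values are found by enumerating the trees with one, two and three vertices and
-- counting their leaves.
open Recurrence C refl refl refl C-recurrence

-- Estimates for `M`, `t` and `C` with explicit error terms

module _ where
  open Data.Nat.Solver.+-*-Solver
  open ℕ.≤-Reasoning

  nM≤C : ∀ n → n ℕ.* M n ≤ C n
  nM≤C n = ℕ.*-cancelˡ-≤ 2 (ℕ.+-cancelʳ-≤ (C n) _ _ (begin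
    2 ℕ.* (n ℕ.* M n) ℕ.+ C n   ≡⟨ C-suc n ⟩
    C (suc n)                   ≤⟨ ratio-upper n ⟩
    3 ℕ.* C n                   ≡⟨ ℕ.+-comm (C n) (2 ℕ.* C n) ⟩
    2 ℕ.* C n ℕ.+ C n           ∎))

  -- Substituting `C (suc n) = 2 n Mₙ + C n` into `ratio-lower` and cancelling `suc n * C n` leaves
  -- `2 n Cₙ ≤ 2 n (n + 1) Mₙ`.
  C≤[1+n]M : ∀ n .{{_ : ℕ.NonZero n}} → C n ≤ suc n ℕ.* M n
  C≤[1+n]M n = ℕ.*-cancelˡ-≤ (2 ℕ.* n) {{ℕ.m*n≢0 2 n}} (ℕ.+-cancelʳ-≤ (suc n ℕ.* C n) _ _ (begin
    2 ℕ.* n ℕ.* C n ℕ.+ suc n ℕ.* C n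
      ≡⟨ solve 2 (λ n c → con 2 :* n :* c :+ (con 1 :+ n) :* c := (con 1 :+ con 3 :* n) :* c)
           refl n (C n) ⟩
    suc (3 ℕ.* n) ℕ.* C n
      ≤⟨ ratio-lower n ⟩
    suc n ℕ.* C (suc n)
      ≡⟨ cong (suc n ℕ.*_) (C-suc n) ⟨
    suc n ℕ.* (2 ℕ.* (n ℕ.* M n) ℕ.+ C n)
      ≡⟨ solve 3 (λ n m c → (con 1 :+ n) :* (con 2 :* (n :* m) :+ c) :=
           con 2 :* n :* ((con 1 :+ n) :* m) :+ (con 1 :+ n) :* c) refl n (M n) (C n) ⟩
    2 ℕ.* n ℕ.* (suc n ℕ.* M n) ℕ.+ suc n ℕ.* C n ∎))

  -- The probability never lies below its limit, so the truncated subtractions in the deviation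
  -- estimates are true differences.
  M-nM≤3^t : ∀ k m → let n = k ℕ.+ m in M k ℕ.* (n ℕ.* M n) ≤ 3 ℕ.^ k ℕ.* t n k
  M-nM≤3^t k m = begin
    M k ℕ.* (n ℕ.* M n)          ≤⟨ ℕ.*-monoʳ-≤ (M k) (nM≤C n) ⟩
    M k ℕ.* C n                  ≤⟨ ℕ.*-monoʳ-≤ (M k) (shift-upper m k) ⟩
    M k ℕ.* (3 ℕ.^ k ℕ.* C m)
      ≡⟨ solve 3 (λ a b c → a :* (b :* c) := b :* (a :* c)) refl (M k) (3 ℕ.^ k) (C m) ⟩
    3 ℕ.^ k ℕ.* (M k ℕ.* C m)    ≡⟨ cong (3 ℕ.^ k ℕ.*_) (t-C k m) ⟨
    3 ℕ.^ k ℕ.* t n k            ∎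
    where
    n = k ℕ.+ m

  deviation : ∀ k m .{{_ : ℕ.NonZero (k ℕ.+ m)}} → let n = k ℕ.+ m in
    m ℕ.* (3 ℕ.^ k ℕ.* t n k ∸ M k ℕ.* (n ℕ.* M n)) ≤ M k ℕ.* suc k ℕ.* (n ℕ.* M n)
  deviation k m = begin
    m ℕ.* (3 ℕ.^ k ℕ.* t n k ∸ M k ℕ.* V)
      ≡⟨ ℕ.*-distribˡ-∸ m (3 ℕ.^ k ℕ.* t n k) (M k ℕ.* V) ⟩
    m ℕ.* (3 ℕ.^ k ℕ.* t n k) ∸ m ℕ.* (M k ℕ.* V)
      ≤⟨ ℕ.∸-monoˡ-≤ (m ℕ.* (M k ℕ.* V)) bound ⟩
    M k ℕ.* suc k ℕ.* V ℕ.+ m ℕ.* (M k ℕ.* V) ∸ m ℕ.* (M k ℕ.* V)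
      ≡⟨ ℕ.m+n∸n≡m (M k ℕ.* suc k ℕ.* V) (m ℕ.* (M k ℕ.* V)) ⟩
    M k ℕ.* suc k ℕ.* V ∎
    where
    n = k ℕ.+ m
    V = n ℕ.* M n
    bound : m ℕ.* (3 ℕ.^ k ℕ.* t n k) ≤ M k ℕ.* suc k ℕ.* V ℕ.+ m ℕ.* (M k ℕ.* V)
    bound = begin
      m ℕ.* (3 ℕ.^ k ℕ.* t n k)
        ≡⟨ cong (λ u → m ℕ.* (3 ℕ.^ k ℕ.* u)) (t-C k m) ⟩
      m ℕ.* (3 ℕ.^ k ℕ.* (M k ℕ.* C m))
        ≡⟨ solve 4 (λ m p a c → m :* (p :* (a :* c)) := a :* (p :* (m :* c)))
             refl m (3 ℕ.^ k) (M k) (C m) ⟩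
      M k ℕ.* (3 ℕ.^ k ℕ.* (m ℕ.* C m))
        ≤⟨ ℕ.*-monoʳ-≤ (M k) (shift-lower m k) ⟩
      M k ℕ.* (n ℕ.* C n)
        ≤⟨ ℕ.*-monoʳ-≤ (M k) (ℕ.*-monoʳ-≤ n (C≤[1+n]M n)) ⟩
      M k ℕ.* (n ℕ.* (suc n ℕ.* M n))
        -- Splitting `1 + n = (1 + k) + m` separates the error from the main term, which `deviation`
        -- subtracts.
        ≡⟨ solve 4 (λ a k m b → let n = k :+ m in
             a :* (n :* ((con 1 :+ n) :* b)) :=
             a :* (con 1 :+ k) :* (n :* b) :+ m :* (a :* (n :* b))) refl (M k) k m (M n) ⟩
      M k ℕ.* suc k ℕ.* V ℕ.+ m ℕ.* (M k ℕ.* V) ∎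

  deviation-small : ∀ k m q .{{_ : ℕ.NonZero (k ℕ.+ m)}} → q ℕ.* (M k ℕ.* suc k) ℕ.< m →
    let n = k ℕ.+ m in
    q ℕ.* (3 ℕ.^ k ℕ.* t n k ∸ M k ℕ.* (n ℕ.* M n)) ℕ.< 3 ℕ.^ k ℕ.* (n ℕ.* M n)
  deviation-small k m q q<m = ℕ.*-cancelˡ-< m _ _ (begin-strict
    m ℕ.* (q ℕ.* a)
      ≡⟨ solve 3 (λ m q a → m :* (q :* a) := q :* (m :* a)) refl m q a ⟩
    q ℕ.* (m ℕ.* a)                   ≤⟨ ℕ.*-monoʳ-≤ q (deviation k m) ⟩
    q ℕ.* (M k ℕ.* suc k ℕ.* V)       ≡⟨ ℕ.*-assoc q (M k ℕ.* suc k) V ⟨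
    q ℕ.* (M k ℕ.* suc k) ℕ.* V       <⟨ ℕ.*-monoˡ-< V {{V≢0}} q<m ⟩
    m ℕ.* V                           ≤⟨ ℕ.*-monoʳ-≤ m (ℕ.m≤n*m V (3 ℕ.^ k) {{ℕ.m^n≢0 3 k}}) ⟩
    m ℕ.* (3 ℕ.^ k ℕ.* V)             ∎)
    where
    n = k ℕ.+ m
    V = n ℕ.* M n
    a = 3 ℕ.^ k ℕ.* t n k ∸ M k ℕ.* V
    V≢0 : ℕ.NonZero V
    V≢0 = ℕ.m*n≢0 n (M n)

  -- Otherwise cubing gives `27ⁿ ≤ q³ Cₙ³ < (n + 1) Cₙ³ ≤ 27ⁿ` by `growth`; the strict step needs
  -- `C n` nonzero, which the contrary assumption itself supplies.
  qC<3^ : ∀ q n → q ℕ.^ 3 ≤ n → q ℕ.* C n ℕ.< 3 ℕ.^ n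
  qC<3^ q n q³≤n = ℕ.≰⇒> λ 3^n≤qC → ℕ.<-irrefl refl (begin-strict
    27 ℕ.^ n                     ≡⟨ ℕ.^-*-assoc 3 3 n ⟩
    3 ℕ.^ (3 ℕ.* n)              ≡⟨ cong (3 ℕ.^_) (ℕ.*-comm 3 n) ⟩
    3 ℕ.^ (n ℕ.* 3)              ≡⟨ ℕ.^-*-assoc 3 n 3 ⟨
    (3 ℕ.^ n) ℕ.^ 3              ≤⟨ ℕ.^-monoˡ-≤ 3 3^n≤qC ⟩
    (q ℕ.* C n) ℕ.^ 3
      ≡⟨ solve 2 (λ q c → (q :* c) :^ 3 := q :^ 3 :* c :^ 3) refl q (C n) ⟩
    q ℕ.^ 3 ℕ.* C n ℕ.^ 3
      <⟨ ℕ.*-monoˡ-< (C n ℕ.^ 3) {{ℕ.m^n≢0 (C n) 3 {{C≢0 3^n≤qC}}}} (s≤s q³≤n) ⟩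
    suc n ℕ.* C n ℕ.^ 3          ≤⟨ growth n ⟩
    27 ℕ.^ n                     ∎)
    where
    C≢0 : 3 ℕ.^ n ≤ q ℕ.* C n → ℕ.NonZero (C n)
    C≢0 3^n≤qC = ℕ.≢-nonZero λ C≡0 → ℕ.<⇒≱ (ℕ.m^n>0 3 n)
      (ℕ.≤-trans 3^n≤qC (ℕ.≤-reflexive (trans (cong (q ℕ.*_) C≡0) (ℕ.*-zeroʳ q))))

  tail-small : ∀ q n → (2 ℕ.* q) ℕ.^ 3 ≤ n → q ℕ.* (C n ℕ.+ C (suc n)) ℕ.< 2 ℕ.* 3 ℕ.^ n
  tail-small q n le = begin-strict
    q ℕ.* (C n ℕ.+ C (suc n))        ≤⟨ ℕ.*-monoʳ-≤ q (ℕ.+-monoʳ-≤ (C n) (ratio-upper n)) ⟩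
    q ℕ.* (C n ℕ.+ 3 ℕ.* C n)
      ≡⟨ solve 2 (λ q c → q :* (c :+ con 3 :* c) := con 2 :* (con 2 :* q :* c)) refl q (C n) ⟩
    2 ℕ.* (2 ℕ.* q ℕ.* C n)          <⟨ ℕ.*-monoʳ-< 2 (qC<3^ (2 ℕ.* q) n le) ⟩
    2 ℕ.* 3 ℕ.^ n                    ∎

-- From natural-number estimates to rational limits

/-*-fromℕ : ∀ i d .{{_ : ℕ.NonZero d}} → (ℤ.+ i ℚ./ d) * fromℕ d ≡ fromℕ i
/-*-fromℕ i (suc d) = ℚ.toℚᵘ-injective (begin
  ℚ.toℚᵘ ((ℤ.+ i ℚ./ suc d) * fromℕ (suc d))
    ≈⟨ ℚ.toℚᵘ-homo-* (ℤ.+ i ℚ./ suc d) (fromℕ (suc d)) ⟩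
  ℚ.toℚᵘ (ℤ.+ i ℚ./ suc d) ℚᵘ.* ℚ.toℚᵘ (fromℕ (suc d))
    ≈⟨ ℚᵘ.*-cong (ℚ.toℚᵘ-fromℚᵘ (ℚᵘ.mkℚᵘ (ℤ.+ i) d)) (toℚᵘ-fromℕ (suc d)) ⟩
  ℚᵘ.mkℚᵘ (ℤ.+ i) d ℚᵘ.* ℚᵘ.mkℚᵘ (ℤ.+ suc d) 0
    ≈⟨ ℚᵘ.*≡* (ℤ.*-assoc (ℤ.+ i) (ℤ.+ suc d) ℤ.1ℤ) ⟩
  ℚᵘ.mkℚᵘ (ℤ.+ i) 0
    ≈⟨ toℚᵘ-fromℕ i ⟨
  ℚ.toℚᵘ (fromℕ i) ∎)
  where open import Relation.Binary.Reasoning.Setoid ℚᵘ.≃-setoid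

fromℕ-mono-< : ∀ {m n} → m ℕ.< n → fromℕ m < fromℕ n
fromℕ-mono-< {m} {n} m<n = ℚ.toℚᵘ-cancel-<
  (ℚᵘ.<-respʳ-≃ (ℚᵘ.≃-sym (toℚᵘ-fromℕ n)) (ℚᵘ.<-respˡ-≃ (ℚᵘ.≃-sym (toℚᵘ-fromℕ m))
    (ℚᵘ.*<* (subst₂ ℤ._<_
      (sym (ℤ.*-identityʳ (ℤ.+ m))) (sym (ℤ.*-identityʳ (ℤ.+ n))) (ℤ.+<+ m<n)))))

fromℕ-nonNeg : ∀ n → NonNegative (fromℕ n)
fromℕ-nonNeg n = ℚ.normalize-nonNeg n 1

fromℕ-∸ : ∀ {m n} → n ≤ m → fromℕ (m ∸ n) ≡ fromℕ m - fromℕ n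
fromℕ-∸ {m} {n} n≤m = begin
  fromℕ (m ∸ n)
    ≡⟨ solve 2 (λ a b → a := a :+ b :- b) refl (fromℕ (m ∸ n)) (fromℕ n) ⟩
  fromℕ (m ∸ n) + fromℕ n - fromℕ n      ≡⟨ cong (_- fromℕ n) (fromℕ-+ (m ∸ n) n) ⟨
  fromℕ (m ∸ n ℕ.+ n) - fromℕ n          ≡⟨ cong (λ a → fromℕ a - fromℕ n) (ℕ.m∸n+n≡m n≤m) ⟩
  fromℕ m - fromℕ n                      ∎
  where
  open ≡-Reasoning
  open Data.Rational.Solver.+-*-Solver

-- Reduces both limits to inequalities in `ℕ`: for `ε = p/q` in lowest terms with `p ≥ 1`, the
-- hypothesis says `a/d < 1/q ≤ ε`, and `e = a/d` is nonnegative.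
small : ∀ e ε {a d} → 0ℚ < ε → e * fromℕ d ≡ fromℕ a → ℚ.↧ₙ ε ℕ.* a ℕ.< d → ∣ e ∣ < ε
small e ε@(mkℚ (ℤ.+ zero) _ _) 0<ε _ _ = contradiction (ℚ.positive 0<ε) λ ()
small e ε@(mkℚ ℤ.-[1+ _ ] _ _) 0<ε _ _ = contradiction (ℚ.positive 0<ε) λ ()
small e ε@(mkℚ (ℤ.+ suc p) q-1 _) {a} {d} 0<ε ed≡a qa<d = subst (_< ε) (sym (ℚ.0≤p⇒∣p∣≡p 0≤e)) e<ε
  where
  q = suc q-1
  instance
    d≢0 : ℕ.NonZero d
    d≢0 = ℕ.>-nonZero (ℕ.≤-<-trans z≤n qa<d)
    d>0 : Positive (fromℕ d)
    d>0 = ℚ.normalize-pos d 1 {{_}} {{d≢0}}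
  0≤e : 0ℚ ℚ.≤ e
  0≤e = ℚ.*-cancelʳ-≤-pos (fromℕ d) (subst₂ ℚ._≤_ (sym (ℚ.*-zeroˡ (fromℕ d))) (sym ed≡a)
    (ℚ.nonNegative⁻¹ (fromℕ a) {{fromℕ-nonNeg a}}))
  εq≡ : ε * fromℕ q ≡ fromℕ (suc p)
  εq≡ = trans (cong (_* fromℕ q) (sym (ℚ.fromℚᵘ-toℚᵘ ε))) (/-*-fromℕ (suc p) q)
  eqd : e * fromℕ (q ℕ.* d) ≡ fromℕ (q ℕ.* a)
  eqd = begin
    e * fromℕ (q ℕ.* d)        ≡⟨ cong (e *_) (fromℕ-* q d) ⟩
    e * (fromℕ q * fromℕ d)
      ≡⟨ solve 3 (λ e q d → e :* (q :* d) := q :* (e :* d)) refl e (fromℕ q) (fromℕ d) ⟩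
    fromℕ q * (e * fromℕ d)    ≡⟨ cong (fromℕ q *_) ed≡a ⟩
    fromℕ q * fromℕ a          ≡⟨ fromℕ-* q a ⟨
    fromℕ (q ℕ.* a)            ∎
    where
    open ≡-Reasoning
    open Data.Rational.Solver.+-*-Solver
  εqd : ε * fromℕ (q ℕ.* d) ≡ fromℕ (suc p ℕ.* d)
  εqd = begin
    ε * fromℕ (q ℕ.* d)         ≡⟨ cong (ε *_) (fromℕ-* q d) ⟩
    ε * (fromℕ q * fromℕ d)     ≡⟨ ℚ.*-assoc ε (fromℕ q) (fromℕ d) ⟨
    ε * fromℕ q * fromℕ d       ≡⟨ cong (_* fromℕ d) εq≡ ⟩
    fromℕ (suc p) * fromℕ d     ≡⟨ fromℕ-* (suc p) d ⟨
    fromℕ (suc p ℕ.* d)         ∎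
    where open ≡-Reasoning
  e<ε : e < ε
  e<ε = ℚ.*-cancelʳ-<-nonNeg (fromℕ (q ℕ.* d)) {{fromℕ-nonNeg (q ℕ.* d)}}
    (subst₂ _<_ (sym eqd) (sym εqd) (fromℕ-mono-< (ℕ.<-≤-trans qa<d (ℕ.m≤n*m d (suc p)))))

⅓^-*-3^ : ∀ k → ⅓ ^ k * fromℕ (3 ℕ.^ k) ≡ 1ℚ
⅓^-*-3^ zero    = refl
⅓^-*-3^ (suc k) = begin
  ⅓ * ⅓ ^ k * fromℕ (3 ℕ.* 3 ℕ.^ k)
    ≡⟨ cong (⅓ * ⅓ ^ k *_) (fromℕ-* 3 (3 ℕ.^ k)) ⟩
  ⅓ * ⅓ ^ k * (fromℕ 3 * fromℕ (3 ℕ.^ k))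
    ≡⟨ solve 2 (λ a b → con ⅓ :* a :* (con (fromℕ 3) :* b) := a :* b)
         refl (⅓ ^ k) (fromℕ (3 ℕ.^ k)) ⟩
  ⅓ ^ k * fromℕ (3 ℕ.^ k)
    ≡⟨ ⅓^-*-3^ k ⟩
  1ℚ ∎
  where
  open ≡-Reasoning
  open Data.Rational.Solver.+-*-Solver

prob-limit : ∀ k → (λ n → prob (suc n) k) ⟶ fromℕ (M k) * ⅓ ^ k
-- The sequence is indexed from `suc n`, so `k + b ≤ n` already gives the strict `b < suc n ∸ k`
-- that `deviation-small` requires.
prob-limit k ε 0<ε = k ℕ.+ b , λ n N≤n → close (suc n) (suc n ∸ k)
  (sym (ℕ.m+[n∸m]≡n (ℕ.m≤n⇒m≤1+n (ℕ.m+n≤o⇒m≤o k N≤n))))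
  (ℕ.+-cancelˡ-< k b (suc n ∸ k) (ℕ.≤-<-trans N≤n (ℕ.≤-reflexive
    (sym (ℕ.m+[n∸m]≡n (ℕ.m≤n⇒m≤1+n (ℕ.m+n≤o⇒m≤o k N≤n)))))))
  where
  q = ℚ.↧ₙ ε
  b = q ℕ.* (M k ℕ.* suc k)
  close : ∀ n m .{{_ : ℕ.NonZero n}} → n ≡ k ℕ.+ m → b ℕ.< m →
          ∣ prob n k - fromℕ (M k) * ⅓ ^ k ∣ < ε
  -- `3ᵏ V` is a common denominator of the probability and its limit.
  close n m refl b<m = small (prob n k - fromℕ (M k) * ⅓ ^ k) ε {a} {3 ℕ.^ k ℕ.* V} 0<ε (begin
    (prob n k - fromℕ (M k) * ⅓ ^ k) * fromℕ (3 ℕ.^ k ℕ.* V)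
      ≡⟨ cong ((prob n k - fromℕ (M k) * ⅓ ^ k) *_) (fromℕ-* (3 ℕ.^ k) V) ⟩
    (prob n k - fromℕ (M k) * ⅓ ^ k) * (fromℕ (3 ℕ.^ k) * fromℕ V)
      ≡⟨ solve 5 (λ p a h c v →
           (p :- a :* h) :* (c :* v) := c :* (p :* v) :- a :* v :* (h :* c)) refl
           (prob n k) (fromℕ (M k)) (⅓ ^ k) (fromℕ (3 ℕ.^ k)) (fromℕ V) ⟩
    fromℕ (3 ℕ.^ k) * (prob n k * fromℕ V) - fromℕ (M k) * fromℕ V * (⅓ ^ k * fromℕ (3 ℕ.^ k))
      ≡⟨ cong₂ (λ x y → fromℕ (3 ℕ.^ k) * x - fromℕ (M k) * fromℕ V * y)
           (/-*-fromℕ (t n k) V {{ℕ.m*n≢0 n (M n)}}) (⅓^-*-3^ k) ⟩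
    fromℕ (3 ℕ.^ k) * fromℕ (t n k) - fromℕ (M k) * fromℕ V * 1ℚ
      ≡⟨ cong₂ _-_ (sym (fromℕ-* (3 ℕ.^ k) (t n k)))
           (trans (ℚ.*-identityʳ (fromℕ (M k) * fromℕ V)) (sym (fromℕ-* (M k) V))) ⟩
    fromℕ (3 ℕ.^ k ℕ.* t n k) - fromℕ (M k ℕ.* V)
      ≡⟨ fromℕ-∸ (M-nM≤3^t k m) ⟨
    fromℕ a ∎) (deviation-small k m q b<m)
    where
    open ≡-Reasoning
    open Data.Rational.Solver.+-*-Solver
    V = n ℕ.* M n
    a = 3 ℕ.^ k ℕ.* t n k ∸ M k ℕ.* V

partialSum : ℕ → ℚ
partialSum n = ∑[ i < n ] (fromℕ (M (suc (toℕ i))) * ⅓ ^ suc (toℕ i))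

partialSum-suc : ∀ n → partialSum (suc n) ≡ partialSum n + fromℕ (M (suc n)) * ⅓ ^ suc n
partialSum-suc n = trans (sum-init-last {n} (u ∘ toℕ)) (cong₂ _+_
  (sum-cong-≗ {n} (λ i → cong u (toℕ-inject₁ i))) (cong u (toℕ-fromℕ n)))
  where
  u : ℕ → ℚ
  u i = fromℕ (M (suc i)) * ⅓ ^ suc i

-- The series telescopes: `M-suc` rearranges to `3 (Cₙ + Cₙ₊₁) = (Cₙ₊₁ + Cₙ₊₂) + 2 Mₙ₊₁`, which
-- divided by `2 · 3ⁿ⁺¹` is one step of the tail.
1-partialSum : ∀ n → (1ℚ - partialSum n) * fromℕ (2 ℕ.* 3 ℕ.^ n) ≡ fromℕ (C n ℕ.+ C (suc n))
1-partialSum zero    = refl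
1-partialSum (suc n) = begin
  (1ℚ - partialSum (suc n)) * fromℕ (2 ℕ.* 3 ℕ.^ suc n)
    ≡⟨ cong₂ (λ p d → (1ℚ - p) * d) (partialSum-suc n)
         (trans (fromℕ-* 2 (3 ℕ.^ suc n)) (cong (fromℕ 2 *_) (fromℕ-* 3 (3 ℕ.^ n)))) ⟩
  (1ℚ - (partialSum n + m * h)) * (fromℕ 2 * (fromℕ 3 * c))
    ≡⟨ solve 4 (λ p m h c →
         (con 1ℚ :- (p :+ m :* h)) :* (con (fromℕ 2) :* (con (fromℕ 3) :* c)) :=
         con (fromℕ 3) :* ((con 1ℚ :- p) :* (con (fromℕ 2) :* c)) :-
         con (fromℕ 2) :* m :* (h :* (con (fromℕ 3) :* c))) refl (partialSum n) m h c ⟩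
  fromℕ 3 * ((1ℚ - partialSum n) * (fromℕ 2 * c)) - fromℕ 2 * m * (h * (fromℕ 3 * c))
    ≡⟨ cong₂ (λ x y → fromℕ 3 * x - fromℕ 2 * m * y)
         (trans (cong ((1ℚ - partialSum n) *_) (sym (fromℕ-* 2 (3 ℕ.^ n)))) (1-partialSum n))
         (trans (cong (h *_) (sym (fromℕ-* 3 (3 ℕ.^ n)))) (⅓^-*-3^ (suc n))) ⟩
  fromℕ 3 * fromℕ (x ℕ.+ y) - fromℕ 2 * m * 1ℚ
    ≡⟨ cong₂ _-_ (sym (fromℕ-* 3 (x ℕ.+ y)))
         (trans (ℚ.*-identityʳ (fromℕ 2 * m)) (sym (fromℕ-* 2 (M (suc n))))) ⟩
  fromℕ (3 ℕ.* (x ℕ.+ y)) - fromℕ (2 ℕ.* M (suc n))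
    ≡⟨ cong (λ s → fromℕ s - fromℕ (2 ℕ.* M (suc n))) 3[x+y]≡ ⟩
  fromℕ (y ℕ.+ z ℕ.+ 2 ℕ.* M (suc n)) - fromℕ (2 ℕ.* M (suc n))
    ≡⟨ fromℕ-∸ (ℕ.m≤n+m (2 ℕ.* M (suc n)) (y ℕ.+ z)) ⟨
  fromℕ (y ℕ.+ z ℕ.+ 2 ℕ.* M (suc n) ∸ 2 ℕ.* M (suc n))
    ≡⟨ cong fromℕ (ℕ.m+n∸n≡m (y ℕ.+ z) (2 ℕ.* M (suc n))) ⟩
  fromℕ (y ℕ.+ z) ∎
  where
  open ≡-Reasoning
  open Data.Rational.Solver.+-*-Solver
  m = fromℕ (M (suc n))
  h = ⅓ ^ suc n
  c = fromℕ (3 ℕ.^ n)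
  x = C n
  y = C (suc n)
  z = C (2 ℕ.+ n)
  3[x+y]≡ : 3 ℕ.* (x ℕ.+ y) ≡ y ℕ.+ z ℕ.+ 2 ℕ.* M (suc n)
  3[x+y]≡ = begin
    3 ℕ.* (x ℕ.+ y)
      ≡⟨ N.solve 2 (λ x y → N.con 3 N.:* (x N.:+ y) N.:=
           y N.:+ (N.con 2 N.:* y N.:+ N.con 3 N.:* x))
           refl x y ⟩
    y ℕ.+ (2 ℕ.* y ℕ.+ 3 ℕ.* x)              ≡⟨ cong (y ℕ.+_) (M-suc n) ⟨
    y ℕ.+ (2 ℕ.* M (suc n) ℕ.+ z)            ≡⟨ cong (y ℕ.+_) (ℕ.+-comm (2 ℕ.* M (suc n)) z) ⟩
    y ℕ.+ (z ℕ.+ 2 ℕ.* M (suc n))            ≡⟨ ℕ.+-assoc y z (2 ℕ.* M (suc n)) ⟨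
    y ℕ.+ z ℕ.+ 2 ℕ.* M (suc n)              ∎
    where module N = Data.Nat.Solver.+-*-Solver

M-series : Series≥1 (λ k → fromℕ (M k) * ⅓ ^ k) 1ℚ
-- The bound is the one of `tail-small` for the denominator of `ε`. As `small` treats nonnegative
-- quantities, it is applied to `1ℚ - partialSum n` and the sign is flipped inside the absolute
-- value.
M-series ε 0<ε = (2 ℕ.* ℚ.↧ₙ ε) ℕ.^ 3 , λ n N≤n →
  subst (_< ε) (∣1-partialSum∣ n)
    (small (1ℚ - partialSum n) ε 0<ε (1-partialSum n) (tail-small (ℚ.↧ₙ ε) n N≤n))
  where
  open Data.Rational.Solver.+-*-Solver
  ∣1-partialSum∣ : ∀ n → ∣ 1ℚ - partialSum n ∣ ≡ ∣ partialSum n - 1ℚ ∣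
  ∣1-partialSum∣ n = trans (sym (ℚ.∣-p∣≡∣p∣ (1ℚ - partialSum n)))
    (cong ∣_∣ (solve 1 (λ p → :- (con 1ℚ :- p) := p :- con 1ℚ) refl (partialSum n)))

mainTheorem9 : (∀ k → 1 ≤ k →
    gf≥1 (λ n → t n k) ≗ monomial (fromℕ (M k)) k ⊘ sqrt 1-2x-3x²)
    × (∀ k → 1 ≤ k →
    (λ n → prob (suc n) k) ⟶ fromℕ (M k) * ⅓ ^ k)
    × Series≥1 (λ k → fromℕ (M k) * ⅓ ^ k) 1ℚ
mainTheorem9 = (λ k _ → gf≥1-t-⊘ k) , (λ k _ → prob-limit k) , M-series
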